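{- Let $G$ be a cubic ($3$-regular) simple graph of order $10$ and let $H$ be a finite simple graph. If $E(H,x)=E(G,x)$, then $H$ is isomorphic to $G$.
   Context: An edge covering of a graph with no isolated vertex is a set of edges such that every vertex is incident with at least one edge of the set. For a graph $H$ of size $m$, $e(H,i)$ denotes the number of edge coverings of $H$ of cardinality $i$, $\rho(H)$ is the minimum size of an edge covering, and the edge cover polynomial is $E(H,x)=\sum_{i=\rho(H)}^{m}e(H,i)x^i$; by convention $E(H,x)=0$ if $H$ has an isolated vertex, and $E(H,x)=1$ if $H$ has no vertices and no edges. Cubic graphs here need not be connected. -}

module Defs where

import Data.Bool
open import Data.Bool using (Bool; true; false; _∧_)
open import Data.Nat using (ℕ; zero; suc; _<ᵇ_; _≡ᵇ_)
open import Data.Fin using (Fin; toℕ)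
import Data.List
open import Data.List using (List; []; _∷_; map; length; filterᵇ; allFin; concatMap)
open import Data.Bool.ListAction using (any; all)
open import Data.Product using (_×_; _,_; proj₁; proj₂)
open import Function.Bundles using (_↔_; Inverse)
open import Relation.Binary.PropositionalEquality using (_≡_)

record Graph (n : ℕ) : Set where
  field
    adj    : Fin n → Fin n → Bool
    sym    : ∀ i j → adj i j ≡ adj j i
    irrefl : ∀ i → adj i i ≡ false
open Graph public

degree : ∀ {n} → Graph n → Fin n → ℕ
degree {n} G v = length (filterᵇ (adj G v) (allFin n))

Cubic : ∀ {n} → Graph n → Set
Cubic {n} G = ∀ v → degree G v ≡ 3

edges : ∀ {n} → Graph n → List (Fin n × Fin n)
edges {n} G =
  concatMap (λ i → map (λ j → (i , j))
              (filterᵇ (λ j → (toℕ i <ᵇ toℕ j) ∧ adj G i j) (allFin n)))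
            (allFin n)

sublists : ∀ {A : Set} → List A → List (List A)
sublists []       = [] ∷ []
sublists (x ∷ xs) = let r = sublists xs in Data.List._++_ r (map (x ∷_) r)

incident : ∀ {n} → Fin n → Fin n × Fin n → Bool
incident v (a , b) = (toℕ v ≡ᵇ toℕ a) Data.Bool.∨ (toℕ v ≡ᵇ toℕ b)

isEdgeCovering : ∀ {n} → List (Fin n × Fin n) → Bool
isEdgeCovering {n} S = all (λ v → any (incident v) S) (allFin n)

-- e(H,i): number of edge coverings of H of cardinality i
-- (automatically 0 for all i when H has an isolated vertex, and
--  e(H,0)=1, e(H,i)=0 otherwise when H has no vertices: matching the
--  conventions E(H,x)=0 resp. E(H,x)=1)
e : ∀ {n} → Graph n → ℕ → ℕ
e G i = length (filterᵇ (λ S → (length S ≡ᵇ i) ∧ isEdgeCovering S)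
                        (sublists (edges G)))

-- the edge cover polynomial E(H,x) = Σ e(H,i) x^i, represented by its
-- coefficient sequence; equality of polynomials = equality of coefficients
EdgeCoverPoly : ∀ {n} → Graph n → (ℕ → ℕ)
EdgeCoverPoly G = e G

record _≅_ {n m : ℕ} (G : Graph n) (H : Graph m) : Set where
  field
    bij      : Fin n ↔ Fin m
    preserve : ∀ i j → adj H (Inverse.to bij i) (Inverse.to bij j) ≡ adj G i j

{-# OPTIONS --safe #-}
module Submission where

-- From e(H,15), e(H,13), e(H,12) and the vanishing above 15 one reads off that H has 15 edges,
-- minimum degree at least 3 and, as an uncovered vertex of a 12-set of edges determines that set,
-- at least 10 vertices; so H is cubic of order 10.  Up to isomorphism there are 21 cubic graphs
-- of order 10, and e(·,5) and e(·,6) tell them apart.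
--
-- The classification is a derivation certified by computation.  A set E of edges is "settled" when
-- every cubic graph containing a copy of E contains a copy of a representative.  If p has degree
-- below 3 in E, then E is settled as soon as every E + pq contains a copy of a settled set; the
-- empty set comes out settled at the end.

open import Defs renaming (sym to adj-sym)
open import Data.Bool using (Bool; true; false; _∧_; _∨_; not; if_then_else_; T; T?)
open import Data.Bool.ListAction using (any; all; or)
open import Data.Bool.Properties using (T-∧; T-∨; ∧-comm; ∨-comm)
open import Data.Empty using (⊥-elim)
open import Data.Fin using (Fin; zero; suc; toℕ; _≟_)
open import Data.Fin.Properties using (toℕ-injective)
open import Data.List using (List; []; _∷_; _++_; map; length; filterᵇ; allFin; null)
open import Data.List.Properties using (length-++; length-map; length-tabulate; map-cong)
open import Data.List.Membership.Propositional using (_∈_; find; lose)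
open import Data.List.Membership.Propositional.Properties
open import Data.List.Membership.Propositional.Properties.WithK using (unique∧set⇒bag)
open import Data.List.Relation.Binary.BagAndSetEquality using (∼bag⇒↭)
open import Data.List.Relation.Binary.Disjoint.Propositional using (Disjoint)
open import Data.List.Relation.Binary.Permutation.Propositional as ↭ using (_↭_; ↭-sym)
open import Data.List.Relation.Binary.Permutation.Propositional.Properties using (↭-length; Any-resp-↭)
open import Data.List.Relation.Unary.All as All using (All; []; _∷_)
import Data.List.Relation.Unary.All.Properties as All
open import Data.List.Relation.Unary.AllPairs as AllPairs using (AllPairs; []; _∷_)
import Data.List.Relation.Unary.AllPairs.Properties as AllPairs
open import Data.List.Relation.Unary.Any as Any using (Any; here; there)
import Data.List.Relation.Unary.Any.Properties as AnyP
open import Data.List.Relation.Unary.Unique.Propositional using (Unique)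
import Data.List.Relation.Unary.Unique.Propositional.Properties as Unique
open import Data.Nat using (ℕ; zero; suc; _+_; _*_; _≤_; _<_; _∸_; _^_; _≡ᵇ_; _<ᵇ_; z≤n; s≤s)
open import Data.List.Relation.Unary.Unique.DecPropositional Data.Nat._≟_ using (unique?)
open import Data.Nat.Combinatorics using (_C_; nCn≡1; k>n⇒nCk≡0; nCk+nC[k+1]≡[n+1]C[k+1])
open import Data.Nat.DivMod using (_/_; _mod_)
open import Data.Nat.ListAction using (sum)
open import Data.Nat.Properties hiding (_≟_)
open import Algebra.Properties.CommutativeSemigroup +-commutativeSemigroup using (interchange; xy∙z≈xz∙y)
open import Data.Product as Product using (∃; _×_; _,_; proj₁; proj₂)
open import Data.Vec using (Vec; []; _∷_; lookup)
open import Data.Sum as Sum using (_⊎_; inj₁; inj₂)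
open import Data.Unit using (tt)
open import Function using (_∘_; id; case_of_)
open import Function.Bundles using (Equivalence; Inverse; mk⇔; mk↔ₛ′)
open import Function.Properties.Inverse using (↔-sym; ↔-trans)
open import Relation.Binary.PropositionalEquality hiding ([_])
open import Relation.Binary.Definitions using (tri<; tri≈; tri>)
open import Relation.Nullary using (¬_; ¬?; yes; no; contradiction; decidable-stable; from-yes)

-- No structural argument is at hand for why the polynomial separates cubic graphs of order 10, so
-- the complete list of 21 is needed, and it has to be verified by evaluation in the type checker.
-- That makes it impractical to search for isomorphisms there, or to run `e`, whose definition lists
-- all 2^15 sets of edges. Hence every copy used in the derivation is given by an explicit
-- permutation, and coefficients are evaluated through the inclusion-exclusion recursion `cover`,
-- proved equal to `e`. The coefficients of an arbitrary cubic `G` are not derived by theory either: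
-- `G` is isomorphic to a representative, `e` is invariant under isomorphism, and the values are
-- computed on the representatives. `H` needs separate treatment because nothing is known about its
-- order: binomial bounds on the number of non-coverings must show it to be cubic of order 10 before
-- the list applies to it.

private variable
  A B : Set
  n   : ℕ

-- Boolean reflection

T-ext : ∀ {a b} → (T a → T b) → (T b → T a) → a ≡ b
T-ext {true}  {true}  _ _ = refl
T-ext {true}  {false} f _ = ⊥-elim (f _)
T-ext {false} {true}  _ g = ⊥-elim (g _)
T-ext {false} {false} _ _ = refl

T-not : ∀ {b} → T (not b) → ¬ T b
T-not {false} _ = λ ()

not-T : ∀ {b} → ¬ T b → T (not b)
not-T {true}  ¬t = ¬t _
not-T {false} _  = _

-- Counting the elements of a list

# : (A → Bool) → List A → ℕ
# p xs = length (filterᵇ p xs)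

#-none : ∀ (xs : List A) → # (λ _ → false) xs ≡ 0
#-none []       = refl
#-none (_ ∷ xs) = #-none xs

#-++ : ∀ (p : A → Bool) xs ys → # p (xs ++ ys) ≡ # p xs + # p ys
#-++ p []       ys = refl
#-++ p (x ∷ xs) ys with p x
... | true  = cong suc (#-++ p xs ys)
... | false = #-++ p xs ys

#-map : ∀ (p : B → Bool) (f : A → B) xs → # p (map f xs) ≡ # (p ∘ f) xs
#-map p f []       = refl
#-map p f (x ∷ xs) with p (f x)
... | true  = cong suc (#-map p f xs)
... | false = #-map p f xs

#-not : ∀ (p : A → Bool) xs → # p xs + # (not ∘ p) xs ≡ length xs
#-not p []       = refl
#-not p (x ∷ xs) with p x
... | true  = cong suc (#-not p xs)
... | false = trans (+-suc _ _) (cong suc (#-not p xs))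

-- Pigeonhole: each element of `xs` is paid for by deleting one occurrence of it from `ys`, and
-- uniqueness keeps the tail of `xs` inside what is left. Degree comparisons and surjectivity below
-- rest on this.
unique-⊆-length : ∀ {xs ys : List A} → Unique xs → (∀ {x} → x ∈ xs → x ∈ ys) →
                  length xs ≤ length ys
unique-⊆-length []          _   = z≤n
unique-⊆-length {xs = x ∷ xs} (x≢ ∷ u) sub with ∈-∃++ (sub (here refl))
... | as , bs , refl = begin
  suc (length xs)             ≤⟨ s≤s (unique-⊆-length u drop-x) ⟩
  suc (length (as ++ bs))     ≡⟨ cong suc (length-++ as) ⟩
  suc (length as + length bs) ≡⟨ +-suc (length as) (length bs) ⟨
  length as + suc (length bs) ≡⟨ length-++ as ⟨
  length (as ++ x ∷ bs)       ∎
  where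
  open ≤-Reasoning
  drop-x : ∀ {y} → y ∈ xs → y ∈ as ++ bs
  drop-x y∈ with ∈-++⁻ as (sub (there y∈))
  ... | inj₁ y∈as         = ∈-++⁺ˡ y∈as
  ... | inj₂ (there y∈bs) = ∈-++⁺ʳ as y∈bs
  ... | inj₂ (here refl)  = contradiction refl (All.lookup x≢ y∈)

unique-↭ : ∀ {xs ys : List A} → Unique xs → Unique ys →
           (∀ {x} → x ∈ xs → x ∈ ys) → (∀ {x} → x ∈ ys → x ∈ xs) → xs ↭ ys
unique-↭ u v f g = ∼bag⇒↭ (unique∧set⇒bag u v (mk⇔ f g))

-- Injectivity is asked on the list only, because `image` in `e-≅` identifies a pair with its swap
-- and is injective merely on lists of ordered edges.
map-unique : ∀ {f : A → B} {xs} → (∀ {x y} → x ∈ xs → y ∈ xs → f x ≡ f y → x ≡ y) →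
             Unique xs → Unique (map f xs)
map-unique inj []       = []
map-unique {f = f} {xs = x ∷ xs} inj (x≢ ∷ u) =
  All.map⁺ (All.tabulate λ y∈ eq → All.lookup x≢ y∈ (inj (here refl) (there y∈) eq))
  ∷ map-unique (λ x∈ y∈ → inj (there x∈) (there y∈)) u

module _ {p : A → Bool} {xs : List A} where

  ∈-filterᵇ⁻ : ∀ {x} → x ∈ filterᵇ p xs → x ∈ xs × T (p x)
  ∈-filterᵇ⁻ = ∈-filter⁻ (T? ∘ p)

  ∈-filterᵇ⁺ : ∀ {x} → x ∈ xs → T (p x) → x ∈ filterᵇ p xs
  ∈-filterᵇ⁺ = ∈-filter⁺ (T? ∘ p)

  filterᵇ-unique : Unique xs → Unique (filterᵇ p xs)
  filterᵇ-unique = Unique.filter⁺ (T? ∘ p)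

module _ {n} {p : Fin n → Bool} where

  all-Fin⁺ : (∀ v → T (p v)) → T (all p (allFin n))
  all-Fin⁺ h = All.all⁻ p {xs = allFin n} (All.tabulate λ {v} _ → h v)

  all-Fin⁻ : T (all p (allFin n)) → ∀ v → T (p v)
  all-Fin⁻ h v = All.lookup (All.all⁺ p (allFin n) h) (∈-allFin v)

-- Counting the sublists of a given length

-- Pascal-style recursion on whether the head is taken, the predicate absorbing the elements already
-- chosen. Identities about coverings thereby become inductions on `xs` with `P` generalised.
count : (List A → Bool) → List A → ℕ → ℕ
count P []       zero    = if P [] then 1 else 0
count P []       (suc i) = 0
count P (x ∷ xs) zero    = count P xs zero
count P (x ∷ xs) (suc i) = count P xs (suc i) + count (P ∘ (x ∷_)) xs i

count-sublists : ∀ (P : List A → Bool) xs i →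
                 # (λ S → (length S ≡ᵇ i) ∧ P S) (sublists xs) ≡ count P xs i
count-sublists P [] zero with P []
... | true  = refl
... | false = refl
count-sublists P [] (suc i) = refl
count-sublists P (x ∷ xs) zero = begin
  # Q (sublists xs ++ map (x ∷_) (sublists xs))     ≡⟨ #-++ Q (sublists xs) _ ⟩
  # Q (sublists xs) + # Q (map (x ∷_) (sublists xs)) ≡⟨ cong₂ _+_ (count-sublists P xs 0) (#-map Q (x ∷_) (sublists xs)) ⟩
  count P xs 0 + # (λ _ → false) (sublists xs)      ≡⟨ cong (count P xs 0 +_) (#-none (sublists xs)) ⟩
  count P xs 0 + 0                                  ≡⟨ +-identityʳ _ ⟩
  count P xs 0                                      ∎
  where
  open ≡-Reasoning
  Q = λ S → (length S ≡ᵇ 0) ∧ P S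
count-sublists P (x ∷ xs) (suc i) = begin
  # Q (sublists xs ++ map (x ∷_) (sublists xs))      ≡⟨ #-++ Q (sublists xs) _ ⟩
  # Q (sublists xs) + # Q (map (x ∷_) (sublists xs)) ≡⟨ cong₂ _+_ (count-sublists P xs (suc i)) (#-map Q (x ∷_) (sublists xs)) ⟩
  count P xs (suc i) + # (Q ∘ (x ∷_)) (sublists xs)  ≡⟨ cong (count P xs (suc i) +_) (count-sublists (P ∘ (x ∷_)) xs i) ⟩
  count P (x ∷ xs) (suc i)                           ∎
  where
  open ≡-Reasoning
  Q = λ S → (length S ≡ᵇ suc i) ∧ P S

e-count : ∀ (G : Graph n) i → e G i ≡ count isEdgeCovering (edges G) i
e-count G = count-sublists isEdgeCovering (edges G)

count-cong : ∀ {P Q : List A → Bool} → (∀ S → P S ≡ Q S) → ∀ xs i → count P xs i ≡ count Q xs i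
count-cong eq []       zero    rewrite eq [] = refl
count-cong eq []       (suc i) = refl
count-cong eq (x ∷ xs) zero    = count-cong eq xs zero
count-cong eq (x ∷ xs) (suc i) =
  cong₂ _+_ (count-cong eq xs (suc i)) (count-cong (eq ∘ (x ∷_)) xs i)

count-map : ∀ (P : List B → Bool) (f : A → B) xs i → count P (map f xs) i ≡ count (P ∘ map f) xs i
count-map P f []       zero    = refl
count-map P f []       (suc i) = refl
count-map P f (x ∷ xs) zero    = count-map P f xs zero
count-map P f (x ∷ xs) (suc i) =
  cong₂ _+_ (count-map P f xs (suc i)) (count-map (P ∘ (f x ∷_)) f xs i)

-- Permuting `xs` also permutes the chosen sublists, so `P` must not see their order. In a swap the
-- four choices for `x` and `y` are regrouped by `interchange`; invariance under the swap itself
-- matters when both are taken.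
count-↭ : ∀ (P : List A → Bool) → (∀ {S S′} → S ↭ S′ → P S ≡ P S′) →
          ∀ {xs ys} → xs ↭ ys → ∀ i → count P xs i ≡ count P ys i
count-↭ P resp ↭.refl              i       = refl
count-↭ P resp (↭.prep x r)        zero    = count-↭ P resp r zero
count-↭ P resp (↭.prep x r)        (suc i) =
  cong₂ _+_ (count-↭ P resp r (suc i)) (count-↭ (P ∘ (x ∷_)) (resp ∘ ↭.prep x) r i)
count-↭ P resp (↭.swap x y r)      zero    = count-↭ P resp r zero
count-↭ P resp (↭.swap {xs} x y r) (suc zero) = trans
  (xy∙z≈xz∙y (count P xs 1) (count (P ∘ (y ∷_)) xs 0) (count (P ∘ (x ∷_)) xs 0))
  (cong₂ _+_ (cong₂ _+_ (count-↭ P resp r 1) (count-↭ (P ∘ (x ∷_)) (resp ∘ ↭.prep x) r 0))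
             (count-↭ (P ∘ (y ∷_)) (resp ∘ ↭.prep y) r 0))
count-↭ P resp (↭.swap {xs} {ys} x y r) (suc (suc i)) = trans
  (interchange (count P xs (2 + i)) (count (P ∘ (y ∷_)) xs (1 + i))
               (count (P ∘ (x ∷_)) xs (1 + i)) (count (P ∘ (x ∷_) ∘ (y ∷_)) xs i))
  (cong₂ _+_
    (cong₂ _+_ (count-↭ P resp r (2 + i)) (count-↭ (P ∘ (x ∷_)) (resp ∘ ↭.prep x) r (1 + i)))
    (cong₂ _+_ (count-↭ (P ∘ (y ∷_)) (resp ∘ ↭.prep y) r (1 + i))
      (trans (count-↭ (P ∘ (x ∷_) ∘ (y ∷_)) (resp ∘ ↭.prep x ∘ ↭.prep y) r i)
             (count-cong (λ S → resp (↭.swap x y (↭.refl {xs = S}))) ys i))))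
count-↭ P resp (↭.trans r s) i = trans (count-↭ P resp r i) (count-↭ P resp s i)

count-not : ∀ (P : List A → Bool) xs i →
            count P xs i + count (not ∘ P) xs i ≡ count (λ _ → true) xs i
count-not P []       zero with P []
... | true  = refl
... | false = refl
count-not P []       (suc i) = refl
count-not P (x ∷ xs) zero    = count-not P xs zero
count-not P (x ∷ xs) (suc i) = trans
  (interchange (count P xs (suc i)) (count (P ∘ (x ∷_)) xs i) (count (not ∘ P) xs (suc i)) _)
  (cong₂ _+_ (count-not P xs (suc i)) (count-not (P ∘ (x ∷_)) xs i))

count-all : ∀ (xs : List A) i → count (λ _ → true) xs i ≡ length xs C i
count-all []       zero    = refl
count-all []       (suc i) = refl
count-all (x ∷ xs) zero    = count-all xs zero
count-all (x ∷ xs) (suc i) = begin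
  count (λ _ → true) xs (suc i) + count (λ _ → true) xs i
    ≡⟨ cong₂ _+_ (count-all xs (suc i)) (count-all xs i) ⟩
  length xs C suc i + length xs C i ≡⟨ +-comm (length xs C suc i) _ ⟩
  length xs C i + length xs C suc i ≡⟨ nCk+nC[k+1]≡[n+1]C[k+1] (length xs) i ⟩
  suc (length xs) C suc i           ∎
  where open ≡-Reasoning

count-> : ∀ (P : List A → Bool) xs i → length xs < i → count P xs i ≡ 0
count-> P xs i lt = m+n≡0⇒m≡0 (count P xs i)
  (trans (count-not P xs i) (trans (count-all xs i) (k>n⇒nCk≡0 lt)))

count-none : ∀ (xs : List A) i → count (λ _ → false) xs i ≡ 0
count-none []       zero    = refl
count-none []       (suc i) = refl
count-none (x ∷ xs) zero    = count-none xs zero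
count-none (x ∷ xs) (suc i) = cong₂ _+_ (count-none xs (suc i)) (count-none xs i)

-- The sublists that avoid `p` are the sublists of the part of `xs` outside `p`.
count-avoiding : ∀ (p : A → Bool) xs i → count (λ S → not (any p S)) xs i ≡ # (not ∘ p) xs C i
count-avoiding p []       zero    = refl
count-avoiding p []       (suc i) = refl
count-avoiding p (x ∷ xs) zero    = count-avoiding p xs zero
count-avoiding p (x ∷ xs) (suc i) with p x
-- Taking `x` makes the condition constantly false.
... | true  = trans (cong₂ _+_ (count-avoiding p xs (suc i)) (count-none xs i)) (+-identityʳ _)
... | false = begin
  count Q xs (suc i) + count Q xs i ≡⟨ cong₂ _+_ (count-avoiding p xs (suc i)) (count-avoiding p xs i) ⟩
  k C suc i + k C i                 ≡⟨ +-comm (k C suc i) (k C i) ⟩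
  k C i + k C suc i                 ≡⟨ nCk+nC[k+1]≡[n+1]C[k+1] k i ⟩
  suc k C suc i                     ∎
  where
  open ≡-Reasoning
  Q = λ S → not (any p S)
  k = # (not ∘ p) xs

count-mono : ∀ {P Q : List A → Bool} → (∀ S → T (P S) → T (Q S)) → ∀ xs i →
             count P xs i ≤ count Q xs i
count-mono {P = P} {Q} imp [] zero with P [] | Q [] | imp []
... | true  | true  | _ = ≤-refl
... | true  | false | f = ⊥-elim (f _)
... | false | _     | _ = z≤n
count-mono imp []       (suc i) = z≤n
count-mono imp (x ∷ xs) zero    = count-mono imp xs zero
count-mono imp (x ∷ xs) (suc i) =
  +-mono-≤ (count-mono imp xs (suc i)) (count-mono (imp ∘ (x ∷_)) xs i)

count-∨ : ∀ (P Q : List A → Bool) xs i →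
          count (λ S → P S ∨ Q S) xs i ≤ count P xs i + count Q xs i
count-∨ P Q [] zero with P [] | Q []
... | true  | _     = s≤s z≤n
... | false | true  = ≤-refl
... | false | false = z≤n
count-∨ P Q []       (suc i) = z≤n
count-∨ P Q (x ∷ xs) zero    = count-∨ P Q xs zero
count-∨ P Q (x ∷ xs) (suc i) = ≤-trans
  (+-mono-≤ (count-∨ P Q xs (suc i)) (count-∨ (P ∘ (x ∷_)) (Q ∘ (x ∷_)) xs i))
  (≤-reflexive (interchange (count P xs (suc i)) (count Q xs (suc i)) (count (P ∘ (x ∷_)) xs i) _))

count-any : ∀ (P : B → List A → Bool) vs xs i →
            count (λ S → any (λ v → P v S) vs) xs i ≤ sum (map (λ v → count (P v) xs i) vs)
count-any P []       xs i = ≤-reflexive (count-none xs i)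
count-any P (v ∷ vs) xs i = ≤-trans
  (count-∨ (P v) _ xs i)
  (+-monoʳ-≤ (count (P v) xs i) (count-any P vs xs i))

not-all : ∀ (p : A → Bool) xs → not (all p xs) ≡ any (not ∘ p) xs
not-all p []       = refl
not-all p (x ∷ xs) with p x
... | true  = not-all p xs
... | false = refl

-- Covered and uncovered vertices

incident⁻ : ∀ (v : Fin n) x → T (incident v x) → v ≡ proj₁ x ⊎ v ≡ proj₂ x
incident⁻ v (a , b) t with Equivalence.to T-∨ t
... | inj₁ eq = inj₁ (toℕ-injective (≡ᵇ⇒≡ _ _ eq))
... | inj₂ eq = inj₂ (toℕ-injective (≡ᵇ⇒≡ _ _ eq))

incident⁺ : ∀ (v : Fin n) x → v ≡ proj₁ x ⊎ v ≡ proj₂ x → T (incident v x)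
incident⁺ v (a , b) (inj₁ eq) = Equivalence.from T-∨ (inj₁ (≡⇒≡ᵇ _ _ (cong toℕ eq)))
incident⁺ v (a , b) (inj₂ eq) = Equivalence.from (T-∨ {toℕ v ≡ᵇ toℕ a}) (inj₂ (≡⇒≡ᵇ _ _ (cong toℕ eq)))

covering⁻ : ∀ (S : List (Fin n × Fin n)) → T (isEdgeCovering S) → ∀ v → Any (T ∘ incident v) S
covering⁻ S t v = AnyP.any⁻ (incident v) S (all-Fin⁻ t v)

covering⁺ : ∀ (S : List (Fin n × Fin n)) → (∀ v → Any (T ∘ incident v) S) → T (isEdgeCovering S)
covering⁺ S h = all-Fin⁺ λ v → AnyP.any⁺ (incident v) (h v)

module _ (G : Graph n) where

  incidence avoidance : Fin n → ℕ
  incidence v = # (incident v) (edges G)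
  avoidance v = # (not ∘ incident v) (edges G)

  size : ℕ
  size = length (edges G)

  e-> : ∀ i → size < i → e G i ≡ 0
  e-> i lt = trans (e-count G i) (count-> isEdgeCovering (edges G) i lt)

  private
    uncovered : List (Fin n × Fin n) → Bool
    uncovered S = not (isEdgeCovering S)

    e+uncovered : ∀ i → e G i + count uncovered (edges G) i ≡ size C i
    e+uncovered i = begin
      e G i + count uncovered (edges G) i
        ≡⟨ cong (_+ count uncovered (edges G) i) (e-count G i) ⟩
      count isEdgeCovering (edges G) i + count uncovered (edges G) i
        ≡⟨ count-not isEdgeCovering (edges G) i ⟩
      count (λ _ → true) (edges G) i ≡⟨ count-all (edges G) i ⟩
      size C i                       ∎
      where open ≡-Reasoning

  -- Coverings and sets that avoid `v` are disjoint families of `i`-sets of edges.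
  e+avoidance≤ : ∀ v i → e G i + avoidance v C i ≤ size C i
  e+avoidance≤ v i = begin
    e G i + avoidance v C i ≡⟨ cong (e G i +_) (count-avoiding (incident v) (edges G) i) ⟨
    e G i + count (λ S → not (any (incident v) S)) (edges G) i
      ≤⟨ +-monoʳ-≤ (e G i) (count-mono missed (edges G) i) ⟩
    e G i + count uncovered (edges G) i ≡⟨ e+uncovered i ⟩
    size C i ∎
    where
    open ≤-Reasoning
    missed : ∀ S → T (not (any (incident v) S)) → T (uncovered S)
    missed S t with any (incident v) S in eq | isEdgeCovering S in eq′
    ... | false | false = _
    ... | false | true  =
      ⊥-elim (subst T eq (all-Fin⁻ {p = λ v → any (incident v) S} (subst T (sym eq′) _) v))

  -- Union bound: a set that is no covering avoids some vertex.
  ≤e+avoidances : ∀ i → size C i ≤ e G i + sum (map (λ v → avoidance v C i) (allFin n))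
  ≤e+avoidances i = begin
    size C i                            ≡⟨ e+uncovered i ⟨
    e G i + count uncovered (edges G) i ≡⟨ cong (e G i +_) (count-cong (λ S → not-all _ (allFin n)) (edges G) i) ⟩
    e G i + count (λ S → any (λ v → not (any (incident v) S)) (allFin n)) (edges G) i
      ≤⟨ +-monoʳ-≤ (e G i) (count-any (λ v S → not (any (incident v) S)) (allFin n) (edges G) i) ⟩
    e G i + sum (map (λ v → count (λ S → not (any (incident v) S)) (edges G) i) (allFin n))
      ≡⟨ cong (λ xs → e G i + sum xs) (map-cong (λ v → count-avoiding (incident v) (edges G) i) (allFin n)) ⟩
    e G i + sum (map (λ v → avoidance v C i) (allFin n)) ∎
    where open ≤-Reasoning

-- Sums over lists and the handshake bound

sum-≤ : ∀ (f : A → ℕ) c xs → (∀ x → f x ≤ c) → sum (map f xs) ≤ length xs * c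
sum-≤ f c []       h = z≤n
sum-≤ f c (x ∷ xs) h = +-mono-≤ (h x) (sum-≤ f c xs h)

sum-≥ : ∀ (f : A → ℕ) c xs → (∀ x → c ≤ f x) → length xs * c ≤ sum (map f xs)
sum-≥ f c []       h = z≤n
sum-≥ f c (x ∷ xs) h = +-mono-≤ (h x) (sum-≥ f c xs h)

sum-+ : ∀ (f g : A → ℕ) xs → sum (map (λ x → f x + g x) xs) ≡ sum (map f xs) + sum (map g xs)
sum-+ f g []       = refl
sum-+ f g (x ∷ xs) = trans (cong (f x + g x +_) (sum-+ f g xs)) (interchange (f x) (g x) _ _)

sum-0 : ∀ (xs : List A) → sum (map (λ _ → 0) xs) ≡ 0
sum-0 []       = refl
sum-0 (_ ∷ xs) = sum-0 xs

-- An excess in one term cannot be compensated, since no other term falls below `c`.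
sum-tight : ∀ (f : A → ℕ) c xs → (∀ x → c ≤ f x) → sum (map f xs) ≤ length xs * c →
            ∀ {x} → x ∈ xs → f x ≤ c
sum-tight f c (x ∷ xs) h le (here refl) = +-cancelʳ-≤ _ _ _
  (≤-trans (+-monoʳ-≤ (f x) (sum-≥ f c xs h)) le)
sum-tight f c (x ∷ xs) h le (there y∈) = sum-tight f c xs h
  (+-cancelˡ-≤ c _ _ (≤-trans (+-monoˡ-≤ _ (h x)) le)) y∈

-- Double counting of the related pairs: the sum runs over `vs`, the induction over `xs`, and each
-- `x` contributes at most `c`.
sum-# : ∀ (p : B → A → Bool) vs xs c → (∀ x → # (λ v → p v x) vs ≤ c) →
        sum (map (λ v → # (p v) xs) vs) ≤ length xs * c
sum-# p vs []       c h = ≤-reflexive (sum-0 vs)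
sum-# {B = B} p vs (x ∷ xs) c h = begin
  sum (map (λ v → # (p v) (x ∷ xs)) vs)  ≡⟨ cong sum (map-cong (λ v → split v) vs) ⟩
  sum (map (λ v → indicator v + # (p v) xs) vs) ≡⟨ sum-+ indicator (λ v → # (p v) xs) vs ⟩
  sum (map indicator vs) + sum (map (λ v → # (p v) xs) vs)
    ≤⟨ +-mono-≤ (≤-trans (≤-reflexive (sum-indicator vs)) (h x)) (sum-# p vs xs c h) ⟩
  c + length xs * c ∎
  where
  open ≤-Reasoning
  indicator : B → ℕ
  indicator v = if p v x then 1 else 0
  split : ∀ v → # (p v) (x ∷ xs) ≡ indicator v + # (p v) xs
  split v with p v x
  ... | true  = refl
  ... | false = refl
  sum-indicator : ∀ vs → sum (map indicator vs) ≡ # (λ v → p v x) vs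
  sum-indicator []       = refl
  sum-indicator (v ∷ vs) with p v x
  ... | true  = cong suc (sum-indicator vs)
  ... | false = sum-indicator vs

incidence-sum : ∀ (G : Graph n) → sum (map (incidence G) (allFin n)) ≤ size G * 2
incidence-sum {n} G = sum-# incident (allFin n) (edges G) 2 λ x →
  unique-⊆-length {ys = proj₁ x ∷ proj₂ x ∷ []} (filterᵇ-unique (Unique.allFin⁺ n)) λ v∈ →
    case incident⁻ _ x (proj₂ (∈-filterᵇ⁻ {p = λ v → incident v x} {xs = allFin n} v∈)) of λ where
      (inj₁ eq) → here eq
      (inj₂ eq) → there (here eq)

-- Size, degrees and order read off from the coefficients

1≤nCk : ∀ {k n} → k ≤ n → 1 ≤ n C k
1≤nCk {zero}  {n}     _         = ≤-refl
1≤nCk {suc k} {suc n} (s≤s k≤n) = ≤-trans (1≤nCk k≤n)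
  (≤-trans (m≤m+n (n C k) (n C suc k)) (≤-reflexive (nCk+nC[k+1]≡[n+1]C[k+1] n k)))

nCk≤1 : ∀ {k n} → n ≤ k → n C k ≤ 1
nCk≤1 {k} {n} n≤k with m≤n⇒m<n∨m≡n n≤k
... | inj₁ n<k  = ≤-trans (≤-reflexive (k>n⇒nCk≡0 n<k)) z≤n
... | inj₂ refl = ≤-reflexive (nCn≡1 n)

-- The values on a cubic graph of order 10. Omitting two of its 15 edges leaves every vertex
-- covered, whence 105 = C(15,13). Omitting three fails exactly when they are the three edges at one
-- vertex, whence 445 = C(15,12) - 10.
record CubicCoefficients (c : ℕ → ℕ) : Set where
  field
    c₁₂ : c 12 ≡ 445
    c₁₃ : c 13 ≡ 105
    c₁₅ : c 15 ≡ 1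
    c>  : ∀ i → 15 < i → c i ≡ 0

module Recognition {m} (H : Graph m) (coeffs : CubicCoefficients (e H)) where
  open CubicCoefficients coeffs
  open ≤-Reasoning

  avoidance≤ : ∀ v → avoidance H v ≤ size H
  avoidance≤ v = ≤-trans (m≤n+m _ (incidence H v)) (≤-reflexive (#-not (incident v) (edges H)))

  15≤size : 15 ≤ size H
  15≤size = ≮⇒≥ λ lt → 1+n≢0 (trans (sym c₁₅) (e-> H 15 lt))

  -- If every edge avoided `v`, all C(size,15) sets of 15 edges would miss `v`, leaving no room for
  -- the one covering of that size.
  no-isolated : ∀ v → avoidance H v < size H
  no-isolated v = ≤∧≢⇒< (avoidance≤ v) λ eq → 1+n≰n (begin
    1 + size H C 15             ≡⟨ cong₂ _+_ c₁₅ (cong (_C 15) eq) ⟨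
    e H 15 + avoidance H v C 15 ≤⟨ e+avoidance≤ H v 15 ⟩
    size H C 15                 ∎)

  -- Without isolated vertices the full edge set is a covering, so the coefficient at `size H`
  -- cannot vanish.
  size≤15 : size H ≤ 15
  size≤15 = ≮⇒≥ λ lt → n≮0 (begin
    1                   ≡⟨ nCn≡1 (size H) ⟨
    size H C size H     ≤⟨ ≤e+avoidances H (size H) ⟩
    e H (size H) + sum (map (λ v → avoidance H v C size H) (allFin m))
                        ≡⟨ cong₂ _+_ (c> (size H) lt) (cong sum (map-cong (λ v → k>n⇒nCk≡0 (no-isolated v)) (allFin m))) ⟩
    sum (map (λ _ → 0) (allFin m)) ≡⟨ sum-0 (allFin m) ⟩
    0                   ∎)

  size≡15 : size H ≡ 15
  size≡15 = ≤-antisym size≤15 15≤size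

  -- Thirteen edges avoiding `v` would form a 13-set that is no covering, but all 105 = C(15,13)
  -- sets of that size are coverings.
  avoidance≤12 : ∀ v → avoidance H v ≤ 12
  avoidance≤12 v = ≮⇒≥ λ lt → 1+n≰n (begin
    106                         ≤⟨ +-mono-≤ (≤-reflexive (sym c₁₃)) (1≤nCk lt) ⟩
    e H 13 + avoidance H v C 13 ≤⟨ e+avoidance≤ H v 13 ⟩
    size H C 13                 ≡⟨ cong (_C 13) size≡15 ⟩
    105                         ∎)

  3≤incidence : ∀ v → 3 ≤ incidence H v
  3≤incidence v = +-cancelʳ-≤ 12 _ _ (begin
    15                            ≡⟨ size≡15 ⟨
    size H                        ≡⟨ #-not (incident v) (edges H) ⟨
    incidence H v + avoidance H v ≤⟨ +-monoʳ-≤ (incidence H v) (avoidance≤12 v) ⟩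
    incidence H v + 12            ∎)

  length-allFin : length (allFin m) ≡ m
  length-allFin = length-tabulate id

  10≤m : 10 ≤ m
  10≤m = +-cancelˡ-≤ 445 _ _ (begin
    -- 455 = C(15,12), so exactly ten 12-sets fail to cover, and each vertex accounts for at most
    -- one of them.
    455         ≡⟨ cong (_C 12) size≡15 ⟨
    size H C 12 ≤⟨ ≤e+avoidances H 12 ⟩
    e H 12 + sum (map (λ v → avoidance H v C 12) (allFin m))
      ≤⟨ +-mono-≤ (≤-reflexive c₁₂) (sum-≤ _ 1 (allFin m) (nCk≤1 ∘ avoidance≤12)) ⟩
    445 + length (allFin m) * 1 ≡⟨ cong (445 +_) (trans (*-identityʳ _) length-allFin) ⟩
    445 + m ∎)

  incidence≤30 : sum (map (incidence H) (allFin m)) ≤ 30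
  incidence≤30 = ≤-trans (incidence-sum H) (≤-reflexive (cong (_* 2) size≡15))

  m≡10 : m ≡ 10
  m≡10 = ≤-antisym (*-cancelʳ-≤ m 10 3 (begin
    m * 3                                ≡⟨ cong (_* 3) length-allFin ⟨
    length (allFin m) * 3                ≤⟨ sum-≥ _ 3 (allFin m) 3≤incidence ⟩
    sum (map (incidence H) (allFin m))   ≤⟨ incidence≤30 ⟩
    30                                   ∎)) 10≤m

  incidence≡3 : ∀ v → incidence H v ≡ 3
  incidence≡3 v = ≤-antisym (sum-tight _ 3 (allFin m) 3≤incidence
    (≤-trans incidence≤30 (≤-reflexive (cong (_* 3) (sym (trans length-allFin m≡10))))) (∈-allFin v))
    (3≤incidence v)

-- Edges as an unordered set of pairs

-- The normal form in which `edges` lists a pair: smaller end first.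
orient : Fin n × Fin n → Fin n × Fin n
orient (a , b) = if toℕ a <ᵇ toℕ b then (a , b) else (b , a)

orient-cases : ∀ (x : Fin n × Fin n) → orient x ≡ x ⊎ orient x ≡ Product.swap x
orient-cases (a , b) with toℕ a <ᵇ toℕ b
... | true  = inj₁ refl
... | false = inj₂ refl

orient-< : ∀ {a b : Fin n} → toℕ a < toℕ b → orient (a , b) ≡ (a , b)
orient-< {a = a} {b} lt with toℕ a <ᵇ toℕ b | <⇒<ᵇ lt
... | true | _ = refl

orient-> : ∀ {a b : Fin n} → toℕ b < toℕ a → orient (a , b) ≡ (b , a)
orient-> {a = a} {b} gt with toℕ a <ᵇ toℕ b in eq
... | false = refl
... | true  = contradiction (<ᵇ⇒< (toℕ a) (toℕ b) (subst T (sym eq) _)) (<⇒≯ gt)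

orient-swap : ∀ (a b : Fin n) → orient (a , b) ≡ orient (b , a)
orient-swap a b with <-cmp (toℕ a) (toℕ b)
... | tri< lt _ _ = trans (orient-< lt) (sym (orient-> lt))
... | tri> _ _ gt = trans (orient-> gt) (sym (orient-< gt))
... | tri≈ _ eq _ with refl ← toℕ-injective eq = refl

orient-injective : ∀ {x y : Fin n × Fin n} → orient x ≡ orient y → x ≡ y ⊎ x ≡ Product.swap y
orient-injective {x = x} {y} eq with orient-cases x | orient-cases y
... | inj₁ p | inj₁ q = inj₁ (trans (sym p) (trans eq q))
... | inj₁ p | inj₂ q = inj₂ (trans (sym p) (trans eq q))
... | inj₂ p | inj₁ q = inj₂ (cong Product.swap (trans (sym p) (trans eq q)))
... | inj₂ p | inj₂ q = inj₁ (cong Product.swap (trans (sym p) (trans eq q)))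

incident-orient⁻ : ∀ (v : Fin n) x → T (incident v (orient x)) → T (incident v x)
incident-orient⁻ v x@(a , b) t with orient-cases x
... | inj₁ eq = subst (T ∘ incident v) eq t
... | inj₂ eq = incident⁺ v x (Sum.swap (incident⁻ v (b , a) (subst (T ∘ incident v) eq t)))

incident-orient⁺ : ∀ (v : Fin n) x → T (incident v x) → T (incident v (orient x))
incident-orient⁺ v x@(a , b) t with orient-cases x
... | inj₁ eq = subst (T ∘ incident v) (sym eq) t
... | inj₂ eq = subst (T ∘ incident v) (sym eq) (incident⁺ v (b , a) (Sum.swap (incident⁻ v x t)))

module _ (G : Graph n) where

  private
    row : Fin n → List (Fin n × Fin n)
    row i = map (i ,_) (filterᵇ (λ j → (toℕ i <ᵇ toℕ j) ∧ adj G i j) (allFin n))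

    ∈-row⁻ : ∀ {i x} → x ∈ row i → proj₁ x ≡ i × toℕ i < toℕ (proj₂ x) × T (adj G i (proj₂ x))
    ∈-row⁻ {i} x∈ with ∈-map⁻ (i ,_) x∈
    ... | j , j∈ , refl
      with Equivalence.to T-∧ (proj₂ (∈-filterᵇ⁻ {p = λ j → (toℕ i <ᵇ toℕ j) ∧ adj G i j} {xs = allFin n} j∈))
    ...   | lt , t = refl , <ᵇ⇒< _ _ lt , t

  ∈-edges⁻ : ∀ {a b} → (a , b) ∈ edges G → toℕ a < toℕ b × T (adj G a b)
  ∈-edges⁻ x∈ with find (∈-concatMap⁻ row {xs = allFin n} x∈)
  ... | i , _ , x∈row with ∈-row⁻ x∈row
  ...   | refl , lt , t = lt , t

  ∈-edges⁺ : ∀ {a b} → T (adj G a b) → orient (a , b) ∈ edges G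
  ∈-edges⁺ {a} {b} t with <-cmp (toℕ a) (toℕ b)
  ... | tri< lt _ _ = subst (_∈ edges G) (sym (orient-< lt))
    (∈-concatMap⁺ row (lose (∈-allFin a) (∈-map⁺ (a ,_)
      (∈-filterᵇ⁺ (∈-allFin b) (Equivalence.from T-∧ (<⇒<ᵇ lt , t))))))
  ... | tri> _ _ gt = subst (_∈ edges G) (sym (orient-> gt))
    (∈-concatMap⁺ row (lose (∈-allFin b) (∈-map⁺ (b ,_)
      (∈-filterᵇ⁺ (∈-allFin a) (Equivalence.from T-∧ (<⇒<ᵇ gt , subst T (adj-sym G a b) t))))))
  ... | tri≈ _ eq _ with refl ← toℕ-injective eq = ⊥-elim (subst T (irrefl G a) t)

  edges-unique : Unique (edges G)
  edges-unique = Unique.concat⁺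
    (All.map⁺ (All.tabulate λ _ → Unique.map⁺ (cong proj₂) (filterᵇ-unique (Unique.allFin⁺ n))))
    (AllPairs.map⁺ (AllPairs.map rows-disjoint (Unique.allFin⁺ n)))
    where
    rows-disjoint : ∀ {i j} → i ≢ j → Disjoint (row i) (row j)
    rows-disjoint i≢j (x∈i , x∈j) = i≢j (trans (sym (proj₁ (∈-row⁻ x∈i))) (proj₁ (∈-row⁻ x∈j)))

  -- `spoke` sends each neighbour of `v` to the edge joining them; the edges at `v` are exactly
  -- these images.
  incidence-degree : ∀ v → incidence G v ≡ degree G v
  incidence-degree v = trans
    (↭-length (unique-↭ (filterᵇ-unique edges-unique)
      (map-unique (λ _ _ → spoke-injective) (filterᵇ-unique (Unique.allFin⁺ n)))
      to from))
    (length-map spoke (filterᵇ (adj G v) (allFin n)))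
    where
    spoke : Fin n → Fin n × Fin n
    spoke w = orient (v , w)
    spoke-injective : ∀ {w w′} → spoke w ≡ spoke w′ → w ≡ w′
    spoke-injective eq with orient-injective eq
    ... | inj₁ refl = refl
    ... | inj₂ refl = refl
    to : ∀ {x} → x ∈ filterᵇ (incident v) (edges G) → x ∈ map spoke (filterᵇ (adj G v) (allFin n))
    to {a , b} x∈ with ∈-filterᵇ⁻ {p = incident v} {xs = edges G} x∈
    ... | x∈E , inc with ∈-edges⁻ x∈E | incident⁻ v (a , b) inc
    ...   | lt , t | inj₁ refl = subst (_∈ map spoke (filterᵇ (adj G v) (allFin n))) (orient-< lt)
      (∈-map⁺ spoke (∈-filterᵇ⁺ {p = adj G v} (∈-allFin b) t))
    ...   | lt , t | inj₂ refl = subst (_∈ map spoke (filterᵇ (adj G v) (allFin n))) (orient-> lt)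
      (∈-map⁺ spoke (∈-filterᵇ⁺ {p = adj G v} (∈-allFin a) (subst T (adj-sym G a v) t)))
    from : ∀ {x} → x ∈ map spoke (filterᵇ (adj G v) (allFin n)) → x ∈ filterᵇ (incident v) (edges G)
    from x∈ with ∈-map⁻ spoke x∈
    ... | w , w∈ , refl = ∈-filterᵇ⁺
      (∈-edges⁺ (proj₂ (∈-filterᵇ⁻ {p = adj G v} {xs = allFin n} w∈)))
      (incident-orient⁺ v (v , w) (incident⁺ v (v , w) (inj₁ refl)))

-- Invariance of the coefficients under isomorphism

covering-↭ : ∀ {S S′ : List (Fin n × Fin n)} → S ↭ S′ → isEdgeCovering S ≡ isEdgeCovering S′
covering-↭ {S = S} {S′} r = T-ext
  (λ t → covering⁺ S′ λ v → Any-resp-↭ r (covering⁻ S t v))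
  (λ t → covering⁺ S λ v → Any-resp-↭ (↭-sym r) (covering⁻ S′ t v))

-- An isomorphism need not respect the numbering of the vertices, so transported edges must be
-- reoriented and give `edges H` only up to a permutation. This is what `count-↭` is for.
e-≅ : ∀ {m n} {G : Graph m} {H : Graph n} → G ≅ H → ∀ i → e H i ≡ e G i
e-≅ {m} {n} {G} {H} iso i = begin
  e H i                                      ≡⟨ e-count H i ⟩
  count isEdgeCovering (edges H) i           ≡⟨ count-↭ isEdgeCovering covering-↭ edges-↭ i ⟩
  count isEdgeCovering (map image (edges G)) i ≡⟨ count-map isEdgeCovering image (edges G) i ⟩
  count (isEdgeCovering ∘ map image) (edges G) i ≡⟨ count-cong covering-image (edges G) i ⟩
  count isEdgeCovering (edges G) i           ≡⟨ e-count G i ⟨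
  e G i                                      ∎
  where
  open ≡-Reasoning
  open _≅_ iso
  f : Fin m → Fin n
  f = Inverse.to bij
  g : Fin n → Fin m
  g = Inverse.from bij
  fg : ∀ v → f (g v) ≡ v
  fg v = Inverse.inverseˡ bij refl
  f-injective : ∀ {u v} → f u ≡ f v → u ≡ v
  f-injective {u} {v} eq = trans (sym (Inverse.inverseʳ bij refl)) (Inverse.inverseʳ bij eq)
  image : Fin m × Fin m → Fin n × Fin n
  image (a , b) = orient (f a , f b)
  image-orient : ∀ a b → image (orient (a , b)) ≡ image (a , b)
  image-orient a b with orient-cases (a , b)
  ... | inj₁ eq = cong image eq
  ... | inj₂ eq = trans (cong image eq) (orient-swap (f b) (f a))
  image-injective : ∀ {x y} → x ∈ edges G → y ∈ edges G → image x ≡ image y → x ≡ y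
  image-injective {a , b} {c , d} x∈ y∈ eq with orient-injective eq
  ... | inj₁ eq′ = cong₂ _,_ (f-injective (cong proj₁ eq′)) (f-injective (cong proj₂ eq′))
  ... | inj₂ eq′ with f-injective (cong proj₁ eq′) | f-injective (cong proj₂ eq′)
  -- Here one edge is the other reversed, yet both are listed with the smaller end first.
  ...   | refl | refl = contradiction (proj₁ (∈-edges⁻ G x∈)) (<⇒≯ (proj₁ (∈-edges⁻ G y∈)))
  to : ∀ {x} → x ∈ edges H → x ∈ map image (edges G)
  to {c , d} x∈ with ∈-edges⁻ H x∈
  ... | lt , t = subst (_∈ map image (edges G))
    (trans (image-orient (g c) (g d)) (trans (cong orient (cong₂ _,_ (fg c) (fg d))) (orient-< lt)))
    (∈-map⁺ image (∈-edges⁺ G (subst T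
      (trans (cong₂ (adj H) (sym (fg c)) (sym (fg d))) (preserve (g c) (g d))) t)))
  from : ∀ {x} → x ∈ map image (edges G) → x ∈ edges H
  from x∈ with ∈-map⁻ image x∈
  ... | (a , b) , ab∈ , refl = ∈-edges⁺ H (subst T (sym (preserve a b)) (proj₂ (∈-edges⁻ G ab∈)))
  edges-↭ : edges H ↭ map image (edges G)
  edges-↭ = unique-↭ (edges-unique H) (map-unique image-injective (edges-unique G)) to from
  incident-image⁻ : ∀ u {x} → T (incident (f u) (image x)) → T (incident u x)
  incident-image⁻ u {a , b} t = incident⁺ u (a , b)
    (Sum.map f-injective f-injective (incident⁻ (f u) (f a , f b) (incident-orient⁻ (f u) (f a , f b) t)))
  incident-image⁺ : ∀ v {x} → T (incident (g v) x) → T (incident v (image x))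
  incident-image⁺ v {a , b} t = incident-orient⁺ v (f a , f b) (incident⁺ v (f a , f b)
    (Sum.map (λ eq → trans (sym (fg v)) (cong f eq)) (λ eq → trans (sym (fg v)) (cong f eq))
      (incident⁻ (g v) (a , b) t)))
  covering-image : ∀ S → isEdgeCovering (map image S) ≡ isEdgeCovering S
  covering-image S = T-ext
    (λ t → covering⁺ S λ u → Any.map (incident-image⁻ u) (AnyP.map⁻ (covering⁻ (map image S) t (f u))))
    (λ t → covering⁺ (map image S) λ v → AnyP.map⁺ (Any.map (incident-image⁺ v) (covering⁻ S t (g v))))

-- Embeddings of graphs

-- A copy as a subgraph that need not be induced: `H` may have further edges between the images.
record _↪_ {m n} (G : Graph m) (H : Graph n) : Set where
  field
    vertex    : Fin m → Fin n
    injective : ∀ {i j} → vertex i ≡ vertex j → i ≡ j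
    edge      : ∀ {i j} → T (adj G i j) → T (adj H (vertex i) (vertex j))
open _↪_

↪-trans : ∀ {l m n} {G : Graph l} {H : Graph m} {K : Graph n} → G ↪ H → H ↪ K → G ↪ K
↪-trans f g = record
  { vertex    = vertex g ∘ vertex f
  ; injective = injective f ∘ injective g
  ; edge      = edge g ∘ edge f
  }

module _ {n : ℕ} where
  open import Data.List.Membership.DecPropositional (_≟_ {n}) public using (_∈?_)

neighbours : Graph n → Fin n → List (Fin n)
neighbours {n} G v = filterᵇ (adj G v) (allFin n)

module _ (G : Graph n) {v w : Fin n} where

  ∈-neighbours⁻ : w ∈ neighbours G v → T (adj G v w)
  ∈-neighbours⁻ w∈ = proj₂ (∈-filterᵇ⁻ {p = adj G v} {xs = allFin n} w∈)

  ∈-neighbours⁺ : T (adj G v w) → w ∈ neighbours G v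
  ∈-neighbours⁺ = ∈-filterᵇ⁺ (∈-allFin w)

neighbours-unique : ∀ (G : Graph n) v → Unique (neighbours G v)
neighbours-unique G v = filterᵇ-unique (Unique.allFin⁺ _)

module _ {m n} {G : Graph m} {H : Graph n} (f : G ↪ H) where

  -- The images of the neighbours of `i`, together with `w`, are distinct neighbours of
  -- `vertex f i`.
  new-neighbour-degree : ∀ {i w} → T (adj H (vertex f i) w) → ¬ w ∈ map (vertex f) (neighbours G i) →
                         degree G i < degree H (vertex f i)
  new-neighbour-degree {i} {w} t w∉ = ≤-trans
    (≤-reflexive (cong suc (sym (length-map (vertex f) (neighbours G i)))))
    (unique-⊆-length
      (All.tabulate (λ x∈ eq → w∉ (subst (_∈ map (vertex f) (neighbours G i)) (sym eq) x∈))
        ∷ map-unique (λ _ _ → injective f) (neighbours-unique G i))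
      λ where
        (here refl) → ∈-neighbours⁺ H t
        (there x∈)  → image⊆ x∈)
    where
    image⊆ : ∀ {x} → x ∈ map (vertex f) (neighbours G i) → x ∈ neighbours H (vertex f i)
    image⊆ x∈ with ∈-map⁻ (vertex f) x∈
    ... | y , y∈ , refl = ∈-neighbours⁺ H (edge f (∈-neighbours⁻ G y∈))

  adj-image : ∀ {i j} → vertex f j ∈ map (vertex f) (neighbours G i) → T (adj G i j)
  adj-image {i} fj∈ with ∈-map⁻ (vertex f) fj∈
  ... | k , k∈ , eq = subst (T ∘ adj G i) (sym (injective f eq)) (∈-neighbours⁻ G k∈)

-- A value outside the image would make n + 1 distinct elements of `Fin n`.
injective⇒surjective : ∀ (f : Fin n → Fin n) → (∀ {i j} → f i ≡ f j → i ≡ j) →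
                       ∀ w → ∃ λ v → w ≡ f v
injective⇒surjective {n} f inj w with w ∈? map f (allFin n)
... | yes w∈ = let v , _ , eq = ∈-map⁻ f w∈ in v , eq
... | no  w∉ = contradiction
  (≤-trans (≤-reflexive (cong suc (sym (length-map f (allFin n)))))
    (unique-⊆-length {ys = allFin n}
      (All.tabulate (λ x∈ eq → w∉ (subst (_∈ map f (allFin n)) (sym eq) x∈))
        ∷ map-unique (λ _ _ → inj) (Unique.allFin⁺ n))
      λ _ → ∈-allFin _))
  1+n≰n

-- At equal order the embedding is a bijection on vertices. An edge of `H` that does not come from
-- `G` would give one of its ends a fourth neighbour.
cubic-↪⇒≅ : ∀ {G H : Graph n} → Cubic G → Cubic H → G ↪ H → G ≅ H
cubic-↪⇒≅ {G = G} {H} cG cH f = record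
  { bij      = mk↔ₛ′ (vertex f) (proj₁ ∘ onto) (λ w → sym (proj₂ (onto w)))
                 (λ v → sym (injective f (proj₂ (onto (vertex f v)))))
  ; preserve = λ i j → T-ext (reflect i j) (edge f)
  }
  where
  onto = injective⇒surjective (vertex f) (injective f)
  reflect : ∀ i j → T (adj H (vertex f i) (vertex f j)) → T (adj G i j)
  reflect i j t with vertex f j ∈? map (vertex f) (neighbours G i)
  ... | yes fj∈ = adj-image f fj∈
  ... | no  fj∉ = contradiction (new-neighbour-degree f t fj∉)
    (≤⇒≯ (≤-reflexive (trans (cH (vertex f i)) (sym (cG i)))))

-- Graphs given by edge lists

-- A plain Boolean recursion with no proof attached, since the certificate check evaluates it
-- throughout.
_==_ : Fin n → Fin n → Bool
zero  == zero  = true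
zero  == suc _ = false
suc _ == zero  = false
suc i == suc j = i == j

==⁻ : ∀ {i j : Fin n} → T (i == j) → i ≡ j
==⁻ {i = zero}  {zero}  _ = refl
==⁻ {i = suc i} {suc j} t = cong suc (==⁻ t)

==⁺ : ∀ {i j : Fin n} → i ≡ j → T (i == j)
==⁺ {i = zero}  refl = tt
==⁺ {i = suc i} refl = ==⁺ {i = i} refl

joins : Fin n → Fin n → Fin n × Fin n → Bool
joins i j (a , b) = (i == a ∧ j == b) ∨ (i == b ∧ j == a)

joins-sym : ∀ (i j : Fin n) x → joins i j x ≡ joins j i x
joins-sym i j (a , b) = trans (∨-comm (i == a ∧ j == b) _)
  (cong₂ _∨_ (∧-comm (i == b) (j == a)) (∧-comm (i == a) (j == b)))

-- Excluding `i == j` outright yields a simple graph from any list of pairs, with no well-formedness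
-- condition to carry along.
fromEdges : List (Fin n × Fin n) → Graph n
fromEdges E = record
  { adj    = λ i j → not (i == j) ∧ any (joins i j) E
  ; sym    = λ i j → cong₂ _∧_
      (cong not (T-ext (λ t → ==⁺ (sym (==⁻ {i = i} {j} t))) (λ t → ==⁺ (sym (==⁻ {i = j} {i} t)))))
      (cong or (map-cong (joins-sym i j) E))
  ; irrefl = λ i → cong (λ b → not b ∧ any (joins i i) E) (T-ext _ (λ _ → ==⁺ {i = i} refl))
  }

joins⁻ : ∀ {i j : Fin n} x → T (joins i j x) → x ≡ (i , j) ⊎ x ≡ (j , i)
joins⁻ {i = i} {j} (a , b) t with Equivalence.to T-∨ t
... | inj₁ t′ = let ia , jb = Equivalence.to T-∧ t′ in inj₁ (cong₂ _,_ (sym (==⁻ ia)) (sym (==⁻ jb)))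
... | inj₂ t′ = let ib , ja = Equivalence.to T-∧ t′ in inj₂ (cong₂ _,_ (sym (==⁻ ja)) (sym (==⁻ ib)))

module _ {m n} {H : Graph n} (f : Fin m → Fin n) where

  adj-fromEdges : ∀ {i j x} → T (joins i j x) →
                  T (adj H (f (proj₁ x)) (f (proj₂ x))) → T (adj H (f i) (f j))
  adj-fromEdges {i} {j} {x} t th with joins⁻ {i = i} {j} x t
  ... | inj₁ refl = th
  ... | inj₂ refl = subst T (adj-sym H (f j) (f i)) th

adj-fromEdges⁻ : ∀ (E : List (Fin n × Fin n)) {i j} → T (adj (fromEdges E) i j) →
                 i ≢ j × Any (T ∘ joins i j) E
adj-fromEdges⁻ E {i} {j} t with Equivalence.to T-∧ t
... | t≢ , t∈ = (λ eq → T-not t≢ (==⁺ eq)) , AnyP.any⁻ (joins i j) E t∈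

adj-fromEdges⁺ : ∀ (E : List (Fin n × Fin n)) {i j} → i ≢ j → Any (T ∘ joins i j) E →
                 T (adj (fromEdges E) i j)
adj-fromEdges⁺ E {i} {j} i≢j any = Equivalence.from T-∧ (not-T (i≢j ∘ ==⁻) , AnyP.any⁺ (joins i j) any)

edges-↪ : ∀ {m n} {H : Graph n} (E : List (Fin m × Fin m)) (f : Fin m → Fin n) →
          (∀ {i j} → f i ≡ f j → i ≡ j) →
          (∀ {x} → x ∈ E → T (adj H (f (proj₁ x)) (f (proj₂ x)))) → fromEdges E ↪ H
edges-↪ {H = H} E f inj h = record
  { vertex    = f
  ; injective = inj
  ; edge      = λ {i} {j} t → let i≢j , any = adj-fromEdges⁻ E {i} {j} t ; x , x∈ , t′ = find any in
                  adj-fromEdges {H = H} f {i} {j} {x} t′ (h x∈)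
  }

insert-edge : ∀ {m n} {H : Graph n} (E : List (Fin m × Fin m)) {p q} (f : fromEdges E ↪ H) →
              T (adj H (vertex f p) (vertex f q)) → fromEdges ((p , q) ∷ E) ↪ H
insert-edge {H = H} E {p} {q} f t = record
  { vertex    = vertex f
  ; injective = injective f
  ; edge      = λ {i} {j} tij → let i≢j , any = adj-fromEdges⁻ ((p , q) ∷ E) {i} {j} tij in extended i≢j any
  }
  where
  extended : ∀ {i j} → i ≢ j → Any (T ∘ joins i j) ((p , q) ∷ E) → T (adj H (vertex f i) (vertex f j))
  extended {i} {j} _ (here t′)  = adj-fromEdges {H = H} (vertex f) {i} {j} {p , q} t′ t
  extended i≢j (there t′) = edge f (adj-fromEdges⁺ E i≢j t′)

-- Classification

Edges : ℕ → Set
Edges n = List (Fin n × Fin n)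

-- The candidates for a new neighbour of `p`: in a cubic graph containing `E`, an edge at `p`
-- outside `E` can only lead to such a `q`.
free : Edges n → Fin n → Fin n → Bool
free E p q = not (p == q) ∧ not (adj (fromEdges E) p q) ∧ (degree (fromEdges E) q <ᵇ 3)

absent : ∀ {k} → Fin n → Vec (Fin n) k → Bool
absent x []      = true
absent x (y ∷ σ) = not (x == y) ∧ absent x σ

distinct : ∀ {k} → Vec (Fin n) k → Bool
distinct []      = true
distinct (x ∷ σ) = absent x σ ∧ distinct σ

embeds : Edges n → Vec (Fin n) n → Edges n → Bool
embeds E σ E′ =
  distinct σ ∧ all (λ x → adj (fromEdges E′) (lookup σ (proj₁ x)) (lookup σ (proj₂ x))) E

-- The index counts back from the set settled last; the mapping takes that set into the one at hand.
record Use (n : ℕ) : Set where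
  constructor _via_
  field
    index   : ℕ
    mapping : Vec (Fin n) n

record Node (n : ℕ) : Set where
  constructor node
  field
    start  : Edges n
    pivot  : Fin n
    uses   : List (Use n)
open Node

at : ℕ → List A → (A → Bool) → Bool
at _       []       P = false
at zero    (x ∷ _)  P = P x
at (suc k) (_ ∷ xs) P = at k xs P

checkUses : List (Edges n) → Edges n → Fin n → List (Fin n) → List (Use n) → Bool
checkUses prev E p []       _                = true
checkUses prev E p (q ∷ qs) []               = false
checkUses prev E p (q ∷ qs) ((k via σ) ∷ us) =
  at k prev (λ E′ → embeds E′ σ ((p , q) ∷ E)) ∧ checkUses prev E p qs us

checkNode : List (Edges n) → Node n → Bool
checkNode {n} prev (node E p us) =
  (degree (fromEdges E) p <ᵇ 3) ∧ checkUses prev E p (filterᵇ (free E p) (allFin n)) us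

-- `prev` begins as the representatives and gains each set once its node is checked, so uses only
-- refer backwards. The closing test asks that the empty set be among the settled ones.
check : List (Edges n) → List (Node n) → Bool
check prev []       = any null prev
check prev (N ∷ Ns) = checkNode prev N ∧ check (start N ∷ prev) Ns

-- Soundness of the checker

at-sound : ∀ k (xs : List A) {P : A → Bool} → T (at k xs P) → ∃ λ x → x ∈ xs × T (P x)
at-sound zero    (x ∷ xs) t = x , here refl , t
at-sound (suc k) (_ ∷ xs) t = let x , x∈ , t′ = at-sound k xs t in x , there x∈ , t′

absent-sound : ∀ {k} (x : Fin n) (σ : Vec (Fin n) k) → T (absent x σ) → ∀ i → x ≢ lookup σ i
absent-sound x (y ∷ σ) t i with Equivalence.to (T-∧ {not (x == y)}) t
absent-sound x (y ∷ σ) t zero    | x≠y , _  = λ eq → T-not x≠y (==⁺ eq)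
absent-sound x (y ∷ σ) t (suc i) | _   , tσ = absent-sound x σ tσ i

distinct-sound : ∀ {k} (σ : Vec (Fin n) k) → T (distinct σ) →
                 ∀ i j → lookup σ i ≡ lookup σ j → i ≡ j
distinct-sound (x ∷ σ) t i j eq with Equivalence.to (T-∧ {absent x σ}) t
distinct-sound (x ∷ σ) t zero    zero    eq | tx , tσ = refl
distinct-sound (x ∷ σ) t zero    (suc j) eq | tx , tσ = contradiction eq (absent-sound x σ tx j)
distinct-sound (x ∷ σ) t (suc i) zero    eq | tx , tσ = contradiction (sym eq) (absent-sound x σ tx i)
distinct-sound (x ∷ σ) t (suc i) (suc j) eq | tx , tσ = cong suc (distinct-sound σ tσ i j eq)

embeds-sound : ∀ (E : Edges n) σ E′ → T (embeds E σ E′) → fromEdges E ↪ fromEdges E′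
embeds-sound E σ E′ t with Equivalence.to (T-∧ {distinct σ}) t
... | tσ , tE = edges-↪ E (lookup σ) (distinct-sound σ tσ _ _) (All.lookup (All.all⁺ _ E tE))

module Classification {n} (reps : List (Edges n)) (G : Graph n) (cubic : Cubic G) where

  -- What it means for `E` to be settled, relative to the fixed cubic graph `G`.
  Leads : Edges n → Set
  Leads E = fromEdges E ↪ G → ∃ λ R → R ∈ reps × fromEdges R ↪ G

  -- Otherwise the three neighbours of `vertex f p` would all lie in a list of fewer than three
  -- elements.
  missing-neighbour : ∀ (E : Edges n) p (f : fromEdges E ↪ G) → degree (fromEdges E) p < 3 →
                      ∃ λ w → T (adj G (vertex f p) w) × ¬ w ∈ map (vertex f) (neighbours (fromEdges E) p)
  missing-neighbour E p f p<3
    with Any.any? (λ w → ¬? (w ∈? map (vertex f) (neighbours (fromEdges E) p))) (neighbours G (vertex f p))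
  ... | yes found = let w , w∈ , w∉ = find found in w , ∈-neighbours⁻ G w∈ , w∉
  ... | no  none  = contradiction
    (unique-⊆-length (neighbours-unique G (vertex f p)) λ w∈ →
      decidable-stable (_ ∈? map (vertex f) (neighbours (fromEdges E) p)) λ w∉ → none (lose w∈ w∉))
    (<⇒≱ (subst₂ _<_ (sym (length-map (vertex f) (neighbours (fromEdges E) p)))
                     (sym (cubic (vertex f p))) p<3))

  -- The bound on the degree of `q` comes from the same edge seen from the other end: it is new at
  -- `q` as well, so `E` uses up at most two of the three edges there.
  missing-free : ∀ (E : Edges n) p q (f : fromEdges E ↪ G) → T (adj G (vertex f p) (vertex f q)) →
                 ¬ vertex f q ∈ map (vertex f) (neighbours (fromEdges E) p) → T (free E p q)
  missing-free E p q f t q∉ = Equivalence.from T-∧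
    (not-T (λ p==q → p≢q (==⁻ p==q)) , Equivalence.from T-∧ (not-T ¬adj , <⇒<ᵇ q<3))
    where
    p≢q : p ≢ q
    p≢q refl = subst T (irrefl G (vertex f p)) t
    ¬adj : ¬ T (adj (fromEdges E) p q)
    ¬adj tpq = q∉ (∈-map⁺ (vertex f) (∈-neighbours⁺ (fromEdges E) {p} {q} tpq))
    q<3 : degree (fromEdges E) q < 3
    q<3 = subst (degree (fromEdges E) q <_) (cubic (vertex f q)) (new-neighbour-degree f
      (subst T (adj-sym G (vertex f p) (vertex f q)) t)
      λ p∈ → ¬adj (subst T (adj-sym (fromEdges E) q p) (adj-image f {q} {p} p∈)))

  -- Since `E` lives on as many vertices as `G`, the missing neighbour is the image of some `q`, and
  -- the same vertex map embeds `E` with `pq` added.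
  branch : ∀ (E : Edges n) p → degree (fromEdges E) p < 3 →
           (∀ q → T (free E p q) → Leads ((p , q) ∷ E)) → Leads E
  branch E p p<3 h f with missing-neighbour E p f p<3
  ... | w , t , w∉ with injective⇒surjective (vertex f) (injective f) w
  ...   | q , refl = h q (missing-free E p q f t w∉) (insert-edge E f t)

  checkUses-sound : ∀ {prev} → All Leads prev → ∀ E p qs us → T (checkUses prev E p qs us) →
                    ∀ {q} → q ∈ qs → Leads ((p , q) ∷ E)
  checkUses-sound {prev} leads E p (q ∷ qs) ((k via σ) ∷ us) t q∈
    with Equivalence.to (T-∧ {at k prev (λ E′ → embeds E′ σ ((p , q) ∷ E))}) t
  ... | tq , tqs with q∈
  ...   | there q∈′ = checkUses-sound leads E p qs us tqs q∈′
  ...   | here refl = let E′ , E′∈ , emb = at-sound k prev tq in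
    All.lookup leads E′∈ ∘ ↪-trans (embeds-sound E′ σ ((p , q) ∷ E) emb)

  check-sound : ∀ {prev} → All Leads prev → ∀ Ns → T (check prev Ns) → Leads []
  check-sound {prev} leads [] t with find (AnyP.any⁻ null prev t)
  ... | [] , []∈ , _ = All.lookup leads []∈
  check-sound {prev} leads (node E p us ∷ Ns) t
    with Equivalence.to (T-∧ {checkNode prev (node E p us)}) t
  ... | tN , tNs with Equivalence.to (T-∧ {degree (fromEdges E) p <ᵇ 3}) tN
  ...   | tp , tus = check-sound (branch E p (<ᵇ⇒< _ _ tp) leads-uses ∷ leads) Ns tNs
    where
    leads-uses : ∀ q → T (free E p q) → Leads ((p , q) ∷ E)
    leads-uses q tq = checkUses-sound leads E p (filterᵇ (free E p) (allFin n)) us tus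
      (∈-filterᵇ⁺ (∈-allFin q) tq)

  -- A representative leads to itself, and the empty set embeds in `G` by the identity.
  classify : ∀ Ns → T (check reps Ns) → ∃ λ R → R ∈ reps × fromEdges R ↪ G
  classify Ns t = check-sound (All.tabulate λ {R} R∈ f → R , R∈ , f) Ns t
    (edges-↪ [] id id (λ ()))

-- The coefficients of the representatives

-- A set with `Q` either meets `p` or lies outside it. Stated as a sum, this shows that the
-- truncated subtraction in `cover` is exact.
count-any-∧ : ∀ (p : A → Bool) (Q : List A → Bool) xs t →
              count (λ S → any p S ∧ Q S) xs t + count Q (filterᵇ (not ∘ p) xs) t ≡ count Q xs t
count-any-∧ p Q []       zero    = refl
count-any-∧ p Q []       (suc t) = refl
count-any-∧ p Q (x ∷ xs) zero with p x
... | true  = count-any-∧ p Q xs zero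
... | false = count-any-∧ p Q xs zero
count-any-∧ p Q (x ∷ xs) (suc t) with p x
... | true  = trans
  (xy∙z≈xz∙y (count (λ S → any p S ∧ Q S) xs (suc t)) (count (Q ∘ (x ∷_)) xs t) _)
  (cong (_+ count (Q ∘ (x ∷_)) xs t) (count-any-∧ p Q xs (suc t)))
... | false = trans
  (interchange (count (λ S → any p S ∧ Q S) xs (suc t)) (count (λ S → any p S ∧ Q (x ∷ S)) xs t)
               (count Q (filterᵇ (not ∘ p) xs) (suc t)) _)
  (cong₂ _+_ (count-any-∧ p Q xs (suc t)) (count-any-∧ p (Q ∘ (x ∷_)) xs t))

covered : List (Fin n) → List (Fin n × Fin n) → Bool
covered U S = all (λ v → any (incident v) S) U

-- Inclusion–exclusion: the sets covering v ∷ U are those covering U, less those which also avoid v.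
cover : List (Fin n) → List (Fin n × Fin n) → ℕ → ℕ
cover []      xs t = length xs C t
cover (v ∷ U) xs t =
  if length xs <ᵇ t then 0 else cover U xs t ∸ cover U (filterᵇ (not ∘ incident v) xs) t

cover-count : ∀ U (xs : List (Fin n × Fin n)) t → cover U xs t ≡ count (covered U) xs t
cover-count []      xs t = sym (count-all xs t)
cover-count (v ∷ U) xs t with length xs <ᵇ t in eq
-- The pruned branch: fewer than `t` edges remain, so there are no `t`-sets at all.
... | true  = sym (count-> (covered (v ∷ U)) xs t (<ᵇ⇒< _ _ (subst T (sym eq) tt)))
... | false = begin
  cover U xs t ∸ cover U rest t                          ≡⟨ cong₂ _∸_ (cover-count U xs t) (cover-count U rest t) ⟩
  count (covered U) xs t ∸ count (covered U) rest t      ≡⟨ cong (_∸ count (covered U) rest t) (count-any-∧ (incident v) (covered U) xs t) ⟨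
  count (covered (v ∷ U)) xs t + count (covered U) rest t ∸ count (covered U) rest t
    ≡⟨ m+n∸n≡m (count (covered (v ∷ U)) xs t) (count (covered U) rest t) ⟩
  count (covered (v ∷ U)) xs t                           ∎
  where
  open ≡-Reasoning
  rest = filterᵇ (not ∘ incident v) xs

coefficient : Edges n → ℕ → ℕ
coefficient {n} E = cover (allFin n) (edges (fromEdges E))

coefficient-e : ∀ (E : Edges n) t → coefficient E t ≡ e (fromEdges E) t
coefficient-e {n} E t = trans (cover-count (allFin n) (edges (fromEdges E)) t)
  (sym (e-count (fromEdges E) t))

-- On ten vertices a covering by 5 edges is a perfect matching, so `coefficient E 5` counts those.
-- Packing both coefficients into one number reduces separation to a list of naturals being free of
-- repetitions.
signature : Edges n → ℕ
signature E = 100 * coefficient E 6 + coefficient E 5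

signature-e : ∀ (E E′ : Edges n) → (∀ i → e (fromEdges E) i ≡ e (fromEdges E′) i) →
              signature E ≡ signature E′
signature-e E E′ eq = cong₂ (λ a b → 100 * a + b) (agree 6) (agree 5)
  where
  agree : ∀ t → coefficient E t ≡ coefficient E′ t
  agree t = trans (coefficient-e E t) (trans (eq t) (sym (coefficient-e E′ t)))

record Regular (E : Edges n) : Set where
  field
    cubic   : Cubic (fromEdges E)
    coeffs  : CubicCoefficients (e (fromEdges E))

regular? : Edges n → Bool
regular? {n} E =
  all (λ v → degree (fromEdges E) v ≡ᵇ 3) (allFin n) ∧ (size (fromEdges E) ≡ᵇ 15) ∧
  (coefficient E 12 ≡ᵇ 445) ∧ (coefficient E 13 ≡ᵇ 105) ∧ (coefficient E 15 ≡ᵇ 1)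

regular?-sound : ∀ (E : Edges n) → T (regular? E) → Regular E
regular?-sound {n} E t =
  let td  , t   = Equivalence.to (T-∧ {all (λ v → degree (fromEdges E) v ≡ᵇ 3) (allFin n)}) t
      ts  , t   = Equivalence.to (T-∧ {size (fromEdges E) ≡ᵇ 15}) t
      t₁₂ , t   = Equivalence.to (T-∧ {coefficient E 12 ≡ᵇ 445}) t
      t₁₃ , t₁₅ = Equivalence.to (T-∧ {coefficient E 13 ≡ᵇ 105}) t
  in record
    { cubic   = λ v → ≡ᵇ⇒≡ _ _ (all-Fin⁻ {p = λ v → degree (fromEdges E) v ≡ᵇ 3} td v)
    ; coeffs  = record
      { c₁₂ = trans (sym (coefficient-e E 12)) (≡ᵇ⇒≡ (coefficient E 12) 445 t₁₂)
      ; c₁₃ = trans (sym (coefficient-e E 13)) (≡ᵇ⇒≡ (coefficient E 13) 105 t₁₃)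
      ; c₁₅ = trans (sym (coefficient-e E 15)) (≡ᵇ⇒≡ (coefficient E 15) 1 t₁₅)
      -- The infinitely many vanishing conditions all follow from the single test on the size.
      ; c>  = λ i lt → e-> (fromEdges E) i (subst (_< i) (sym (≡ᵇ⇒≡ (size (fromEdges E)) 15 ts)) lt)
      }
    }

-- From a checked certificate to the determination of the graph

≅-sym : ∀ {m n} {G : Graph m} {H : Graph n} → G ≅ H → H ≅ G
≅-sym {G = G} {H} iso = record
  { bij      = ↔-sym bij
  ; preserve = λ i j → trans (sym (preserve (Inverse.from bij i) (Inverse.from bij j)))
                 (cong₂ (adj H) (Inverse.inverseˡ bij refl) (Inverse.inverseˡ bij refl))
  }
  where open _≅_ iso

≅-trans : ∀ {l m n} {G : Graph l} {H : Graph m} {K : Graph n} → G ≅ H → H ≅ K → G ≅ K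
≅-trans f g = record
  { bij      = ↔-trans (_≅_.bij f) (_≅_.bij g)
  ; preserve = λ i j → trans (_≅_.preserve g _ _) (_≅_.preserve f i j)
  }

cubic-of-order-10 : ∀ {m} (H : Graph m) → CubicCoefficients (e H) → m ≡ 10 × Cubic H
cubic-of-order-10 H coeffs =
  m≡10 , λ v → trans (sym (incidence-degree H v)) (incidence≡3 v)
  where open Recognition H coeffs

-- The order is a variable here because at a literal 10 the type checker would unfold allFin and
-- evaluate the certificates symbolically.
module Determination {n} (n≡10 : n ≡ 10) (reps : List (Edges n)) (derivation : List (Node n))
  (regular : All Regular reps) (distinct : Unique (map signature reps))
  (derived : T (check reps derivation)) where

  representative : ∀ (G : Graph n) → Cubic G → ∃ λ E → E ∈ reps × fromEdges E ≅ G
  representative G cG =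
    let E , E∈ , f = Classification.classify reps G cG derivation derived
    in E , E∈ , cubic-↪⇒≅ (Regular.cubic (All.lookup regular E∈)) cG f

  e-injective : ∀ {E E′} → E ∈ reps → E′ ∈ reps →
                (∀ i → e (fromEdges E) i ≡ e (fromEdges E′) i) → E ≡ E′
  e-injective {E} {E′} E∈ E′∈ eq
    with ∈-AllPairs₂ (AllPairs.map⁻ {R = _≢_} {f = signature} distinct) E∈ E′∈
  ... | inj₁ E≡E′        = E≡E′
  ... | inj₂ (inj₁ sig≢) = contradiction (signature-e E E′ eq) sig≢
  ... | inj₂ (inj₂ sig≢) = contradiction (sym (signature-e E E′ eq)) sig≢

  cubic-determined : (G H : Graph n) → Cubic G → Cubic H → (∀ i → e H i ≡ e G i) → H ≅ G
  cubic-determined G H cG cH eq with representative G cG | representative H cH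
  ... | E , E∈ , E≅G | E′ , E′∈ , E′≅H
    with refl ← e-injective E∈ E′∈ (λ i → trans (sym (e-≅ E≅G i)) (trans (sym (eq i)) (e-≅ E′≅H i)))
    = ≅-trans (≅-sym E′≅H) E≅G

  -- The classification is applied to `G` at once, which supplies the numerical coefficients. They
  -- pass to `H` and make it cubic of the same order, and only then can `H` be classified too.
  determined : (G : Graph n) → Cubic G → ∀ {m} (H : Graph m) → (∀ i → e H i ≡ e G i) → H ≅ G
  determined G cG {m} H eq with representative G cG
  ... | E , E∈ , E≅G = conclude (cubic-of-order-10 H coeffs)
    where
    eH : ∀ i → e H i ≡ e (fromEdges E) i
    eH i = trans (eq i) (e-≅ E≅G i)
    coeffs : CubicCoefficients (e H)
    coeffs = record
      { c₁₂ = trans (eH 12) c₁₂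
      ; c₁₃ = trans (eH 13) c₁₃
      ; c₁₅ = trans (eH 15) c₁₅
      ; c>  = λ i lt → trans (eH i) (c> i lt)
      }
      where open CubicCoefficients (Regular.coeffs (All.lookup regular E∈))
    conclude : m ≡ 10 × Cubic H → H ≅ G
    conclude (m≡10 , cH) with refl ← trans m≡10 (sym n≡10) = cubic-determined G H cG cH eq

-- A k-digit decimal lists the images of 0 , … , k − 1.
digits : ∀ k → ℕ → Vec (Fin 10) k
digits zero    m = []
digits (suc k) m = ((m / 10 ^ k) {{m^n≢0 10 k}}) mod 10 ∷ digits k m

-- Each pair of decimal digits is an edge, the larger endpoint first so that no pair is 00.
pairs : ℕ → ℕ → Edges 10
pairs _       0 = []
pairs zero    _ = []
pairs (suc k) m = ((m / 10) mod 10 , m mod 10) ∷ pairs k (m / 100)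

-- The certificate for order 10

step : ℕ → ℕ → List ℕ → Node 10
-- The last ten digits of `u` are the mapping, those before them the index.
step E p us = node (pairs 15 E) (p mod 10) (map (λ u → (u / 10000000000) via digits 10 u) us)

-- The first eighteen contain the 4-cycle on 0, 1, 2, 3; the last three contain no 4-cycle, and the
-- very last is the Petersen graph. The second and the eighteenth are disconnected: K4 on 6, 7, 8, 9
-- beside K3,3 and beside the triangular prism. The other nineteen are connected.
representatives : List (Edges 10)
representatives = map (pairs 15)
  ( 10_30_40_21_31_32_42_74_65_85_95_86_96_87_97
  ∷ 10_30_40_21_51_32_42_53_54_76_86_96_87_97_98
  ∷ 10_30_40_21_51_32_42_83_54_65_76_96_87_97_98
  ∷ 10_30_40_21_51_32_42_93_64_75_85_76_86_97_98
  ∷ 10_30_40_21_51_32_42_93_64_75_85_76_96_87_98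
  ∷ 10_30_40_21_91_32_52_63_64_84_65_75_87_97_98
  ∷ 10_30_40_21_91_32_52_63_74_84_65_85_96_87_97
  ∷ 10_30_40_21_41_32_52_63_74_65_85_96_87_97_98
  ∷ 10_30_40_21_71_32_52_63_84_94_65_85_96_87_97
  ∷ 10_30_40_21_71_32_52_63_74_94_65_85_96_87_98
  ∷ 10_30_40_21_71_32_52_63_74_84_65_85_96_97_98
  ∷ 10_30_40_21_51_32_52_63_74_84_65_96_87_97_98
  ∷ 10_30_40_21_91_32_52_73_64_84_65_85_76_97_98
  ∷ 10_30_40_21_81_32_52_53_64_94_65_76_87_97_98
  ∷ 10_30_40_21_81_32_52_93_54_64_65_76_87_97_98
  ∷ 10_30_40_21_41_32_52_53_94_65_76_86_87_97_98
  ∷ 10_30_40_21_31_32_52_54_94_65_76_86_87_97_98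
  ∷ 10_30_40_21_51_32_52_43_54_76_86_96_87_97_98
  ∷ 10_40_80_71_81_32_52_92_43_63_64_75_95_76_98
  ∷ 10_40_80_41_71_32_52_92_43_63_75_95_76_86_98
  ∷ 10_30_90_21_61_42_52_43_73_84_75_95_76_86_98
  ∷ [])

derivation : List (Node 10)
derivation =
  -- Vertex 9 still lacks two edges while all others have degree 3. An empty list of uses always
  -- marks such a dead end, a set contained in no cubic graph of order 10.
  step 10_30_40_21_31_32_42_74_65_85_95_76_86_87 9 [] ∷
  step 10_30_40_21_31_32_42_74_65_85_76_86_87 5 (0_0123458769 ∷ []) ∷
  step 10_30_40_21_31_32_42_74_85_95_76_86_87 5 (1_0123458769 ∷ []) ∷
  step 10_30_40_21_31_32_42_74_85_76_86_87 5 (1_0123458769 ∷ 0_0123456789 ∷ []) ∷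
  step 10_30_40_21_31_32_42_74_65_85_95_86_87_97 6 (4_0123456789 ∷ []) ∷
  step 10_30_40_21_31_32_42_74_85_95_86_87_97 5 (0_0123456789 ∷ []) ∷
  step 10_30_40_21_31_32_42_74_85_86_87_97 9 (0_0123456789 ∷ 0_0123465789 ∷ []) ∷
  step 10_30_40_21_31_32_42_74_85_86_87 7 (3_0123465789 ∷ 3_0123456789 ∷ 0_0123456789 ∷ []) ∷
  step 10_30_40_21_31_32_42_74_86_87 8 (0_0123456789 ∷ 0_0123496785 ∷ []) ∷
  step 10_30_40_21_31_32_42_74_87 8 (0_0123465789 ∷ 0_0123456789 ∷ 0_0123459786 ∷ []) ∷
  step 10_30_40_21_31_32_42_74 7 (0_0123468759 ∷ 0_0123458769 ∷ 0_0123456789 ∷ 0_0123456798 ∷ []) ∷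
  step 10_30_40_21_31_32_42 4 (0_0123467589 ∷ 0_0123457689 ∷ 0_0123456789 ∷ 0_0123456879 ∷ 0_0123456978 ∷ []) ∷
  step 10_30_40_21_51_32_42_53_54_76_86_96_97_98 8 (13_0123456897 ∷ []) ∷
  step 10_30_40_21_51_32_42_53_54_76_86_96_97 9 (0_0123456879 ∷ []) ∷
  step 10_30_40_21_51_32_42_53_54_76_86_96 9 (0_0123456987 ∷ 0_0123456879 ∷ []) ∷
  step 10_30_40_21_51_32_42_53_54_76_96 6 (0_0123456897 ∷ []) ∷
  step 10_30_40_21_51_32_42_53_54_96 6 (0_0123456987 ∷ 0_0123456879 ∷ []) ∷
  step 10_30_40_21_51_32_42_53_54 9 (0_0123456789 ∷ 0_0123457689 ∷ 0_0123458679 ∷ []) ∷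
  step 10_30_40_21_51_32_42_63_54_65_76_97_98 9 [] ∷
  step 10_30_40_21_51_32_42_63_54_65_76_97 9 (0_0123456789 ∷ []) ∷
  step 10_30_40_21_51_32_42_63_54_65_76 7 (0_0123456798 ∷ 0_0123456789 ∷ []) ∷
  step 10_30_40_21_51_32_42_63_54_65 6 (0_0123456789 ∷ 0_0123456879 ∷ 0_0123456978 ∷ []) ∷
  step 10_30_40_21_51_32_42_83_54_65_76_96_87_98 7 (24_0123456987 ∷ []) ∷
  step 10_30_40_21_51_32_42_83_54_65_76_96_98 8 (0_0123456987 ∷ []) ∷
  step 10_30_40_21_51_32_42_83_54_65_76_96 8 (0_0123456987 ∷ 0_0123456789 ∷ []) ∷
  step 10_30_40_21_51_32_42_54_65_76_96_87_98 8 (2_0123456987 ∷ []) ∷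
  step 10_30_40_21_51_32_42_54_65_76_96_98 8 (2_0123456789 ∷ 0_0123456987 ∷ []) ∷
  step 10_30_40_21_51_32_42_54_65_76_96 8 (2_0123456987 ∷ 0_0123456987 ∷ 0_0123456789 ∷ []) ∷
  step 10_30_40_21_51_32_42_54_65_76 6 (7_0123456789 ∷ 0_0123456897 ∷ 0_0123456987 ∷ []) ∷
  step 10_30_40_21_51_32_42_54_65 6 (7_0123456789 ∷ 0_0123456789 ∷ 0_0123456879 ∷ 0_0123456978 ∷ []) ∷
  step 10_30_40_21_51_32_42_54 5 (12_0123456789 ∷ 0_0123456789 ∷ 0_0123457689 ∷ 0_0123458679 ∷ 0_0123459678 ∷ []) ∷
  step 10_30_40_21_51_32_42_93_64_75_85_76_86_98 7 (34_0123456879 ∷ []) ∷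
  step 10_30_40_21_51_32_42_93_64_75_85_86_98 7 (0_0123456789 ∷ 0_0124359786 ∷ []) ∷
  step 10_30_40_21_51_32_42_93_64_85_86_98 7 (0_0123456789 ∷ 0_0421369785 ∷ 0_0321496785 ∷ []) ∷
  step 10_30_40_21_51_32_42_93_64_75_85_87_97_98 6 [] ∷
  step 10_30_40_21_51_32_42_93_64_75_85_76_87_98 6 (39_0123456789 ∷ []) ∷
  step 10_30_40_21_51_32_42_93_64_75_85_87_98 7 (0_0123456789 ∷ 1_0123456879 ∷ []) ∷
  step 10_30_40_21_51_32_42_93_64_85_76_87_98 7 (1_0123456789 ∷ 1_0321496785 ∷ []) ∷
  step 10_30_40_21_51_32_42_93_64_85_87_98 7 (1_0123456789 ∷ 0_0123456789 ∷ 1_0321496785 ∷ []) ∷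
  step 10_30_40_21_51_32_42_93_64_85_98 8 (5_0123456789 ∷ 0_0123456789 ∷ []) ∷
  step 10_30_40_21_51_32_42_93_64_85_87 8 (1_0124359786 ∷ 1_0123456789 ∷ []) ∷
  step 10_30_40_21_51_32_42_93_64_85 8 (1_0124359786 ∷ 0_0123456789 ∷ 1_0123456789 ∷ []) ∷
  step 10_30_40_21_51_32_42_93_64_87 8 (1_0123456789 ∷ 1_0421369785 ∷ 1_0321496785 ∷ []) ∷
  step 10_30_40_21_51_32_42_93_64 8 (1_0123456789 ∷ 1_0421369785 ∷ 0_0123456789 ∷ 1_0321496785 ∷ []) ∷
  step 10_30_40_21_51_32_42_64 3 (14_1035246789 ∷ 14_3046215789 ∷ 0_0123456897 ∷ 0_0123456798 ∷ 0_0123456789 ∷ []) ∷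
  step 10_30_40_21_51_32_42 4 (34_0324167589 ∷ 14_0123456789 ∷ 0_0123456789 ∷ 0_0123457689 ∷ 0_0123458679 ∷ 0_0123459678 ∷ []) ∷
  -- This set is K2,3 with parts 0, 2 and 1, 3, 4.
  step 10_30_40_21_32_42 1 (34_0123456789 ∷ 34_0124356789 ∷ 0_0123456789 ∷ 0_0123465789 ∷ 0_0123475689 ∷ 0_0123485679 ∷ 0_0123495678 ∷ []) ∷
  step 10_30_40_21_51_32_52_63_64_84_65_87_97_98 7 [] ∷
  step 10_30_40_21_51_32_52_63_64_84_65_87_98 9 (0_0123456987 ∷ []) ∷
  step 10_30_40_21_51_32_52_63_64_84_65_87 8 (0_0123456987 ∷ []) ∷
  step 10_30_40_21_51_32_52_63_64_84_65 8 (0_0123456789 ∷ 0_0123456987 ∷ []) ∷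
  step 10_30_40_21_51_32_52_63_64_65 4 (0_0123456879 ∷ 0_0123456789 ∷ 0_0123456798 ∷ []) ∷
  step 10_30_40_21_71_32_52_63_64_74_65_75_98 9 [] ∷
  step 10_30_40_21_71_32_52_63_64_74_65_75 8 (0_0123456789 ∷ []) ∷
  step 10_30_40_21_71_32_52_63_64_84_65_75_87_98 9 [] ∷
  step 10_30_40_21_71_32_52_63_64_84_65_75_87 8 (0_0123456789 ∷ []) ∷
  step 10_30_40_21_71_32_52_63_64_65_75_87_98 8 (1_0123456789 ∷ []) ∷
  step 10_30_40_21_71_32_52_63_64_65_75_87 8 (1_0123456789 ∷ 0_0123456789 ∷ []) ∷
  step 10_30_40_21_71_32_52_63_64_65_75 7 (4_0123456789 ∷ 0_0123456789 ∷ 0_0123456798 ∷ []) ∷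
  step 10_30_40_21_91_32_52_63_64_84_65_75_97_98 8 (64_0123456789 ∷ []) ∷
  step 10_30_40_21_91_32_52_63_64_84_65_75_98 9 (0_0123456789 ∷ []) ∷
  step 10_30_40_21_91_32_52_63_64_84_65_75 9 (0_2103546879 ∷ 0_0123456789 ∷ []) ∷
  step 10_30_40_21_91_32_52_63_64_65_75 4 (4_4036725198 ∷ 0_0123456789 ∷ 4_1230964578 ∷ []) ∷
  step 10_30_40_21_32_52_63_64_65_75 1 (12_2103546879 ∷ 4_0123456789 ∷ 0_0123456798 ∷ 0_0123456789 ∷ []) ∷
  step 10_30_40_21_32_52_63_64_65 5 (12_0123456789 ∷ 12_0463152789 ∷ 0_0123456789 ∷ 0_0123456879 ∷ 0_0123456978 ∷ []) ∷
  step 10_30_40_21_91_32_52_63_74_84_65_85_96_98 7 [] ∷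
  step 10_30_40_21_91_32_52_63_74_65_85_96_98 4 (0_0123456789 ∷ []) ∷
  step 10_30_40_21_91_32_52_63_65_85_96_87_98 7 (0_0123456789 ∷ []) ∷
  step 10_30_40_21_91_32_52_63_65_85_96_98 7 (1_0123456789 ∷ 0_0123456789 ∷ []) ∷
  step 10_30_40_21_91_32_52_63_74_65_85_96_87_97 8 (75_0123456789 ∷ []) ∷
  step 10_30_40_21_91_32_52_63_65_85_96_87_97 7 (0_0123456789 ∷ []) ∷
  step 10_30_40_21_91_32_52_63_65_85_96_97 7 (0_5632801749 ∷ 0_0123456789 ∷ []) ∷
  step 10_30_40_21_91_32_52_63_65_85_96 9 (3_5632801749 ∷ 0_0123456789 ∷ 3_0123456789 ∷ []) ∷
  step 10_30_40_21_41_32_52_63_74_65_85_96_87_97 8 (80_0123456789 ∷ []) ∷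
  step 10_30_40_21_41_32_52_63_74_65_85_96_87 7 (0_0123456789 ∷ []) ∷
  step 10_30_40_21_41_32_52_63_74_65_85_96 7 (0_0123456789 ∷ 0_1032465798 ∷ []) ∷
  step 10_30_40_21_41_32_52_63_65_85_96_87_97 7 (2_0123456789 ∷ []) ∷
  step 10_30_40_21_41_32_52_63_65_85_96_87 7 (2_0123456789 ∷ 0_0123456789 ∷ []) ∷
  step 10_30_40_21_41_32_52_63_65_85_96 7 (2_0123456789 ∷ 0_0123456789 ∷ 0_1032465798 ∷ []) ∷
  step 10_30_40_21_71_32_52_63_84_65_85_96_87_97 9 (87_0123456789 ∷ []) ∷
  step 10_30_40_21_71_32_52_63_65_85_96_87_97 8 (0_0123456789 ∷ 2_8965732401 ∷ []) ∷
  step 10_30_40_21_71_32_52_63_74_65_85_96_87_98 4 (90_0123456789 ∷ []) ∷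
  step 10_30_40_21_71_32_52_63_74_65_85_96_87 8 (4_7401832965 ∷ 0_0123456789 ∷ []) ∷
  step 10_30_40_21_71_32_52_63_65_85_96_87 7 (0_0123456789 ∷ 2_0123456789 ∷ []) ∷
  step 10_30_40_21_71_32_52_63_74_84_65_85_96_98 7 (94_0123456789 ∷ []) ∷
  step 10_30_40_21_71_32_52_63_74_84_65_85_96 8 (7_7401832965 ∷ 0_0123456789 ∷ []) ∷
  step 10_30_40_21_71_32_52_63_84_65_85_96 4 (0_0123456789 ∷ 5_1032765498 ∷ []) ∷
  step 10_30_40_21_71_32_52_63_65_85_96_98 9 (4_5632801947 ∷ 1_6523910874 ∷ []) ∷
  step 10_30_40_21_71_32_52_63_65_85_96 8 (1_0123456789 ∷ 4_0123456789 ∷ 0_0123456789 ∷ []) ∷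
  step 10_30_40_21_32_52_63_65_85_96 1 (10_0123456789 ∷ 0_0123456789 ∷ 26_1032865974 ∷ 16_0123456789 ∷ []) ∷
  step 10_30_40_21_32_52_63_74_84_65_96_87_97_98 1 (101_0123456879 ∷ []) ∷
  step 10_30_40_21_32_52_63_74_84_65_96_87_98 7 (16_7401832965 ∷ 1_0123456879 ∷ 0_0123456879 ∷ []) ∷
  step 10_30_40_21_32_52_63_84_65_96_87_98 7 (2_6523910874 ∷ 0_0123456789 ∷ 2_0123456879 ∷ 0_6523910784 ∷ []) ∷
  step 10_30_40_21_32_52_63_84_65_96_98 8 (3_6523910784 ∷ 3_0123456789 ∷ 0_0123456789 ∷ []) ∷
  step 10_30_40_21_32_52_63_84_65_96_87 8 (4_6523910784 ∷ 4_0123456789 ∷ 1_0123456789 ∷ []) ∷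
  step 10_30_40_21_32_52_63_84_65_96 8 (5_6523910784 ∷ 5_0123456789 ∷ 0_0123456789 ∷ 1_0123456789 ∷ []) ∷
  step 10_30_40_21_32_52_63_65_96_87 8 (6_6523910784 ∷ 1_0123456789 ∷ 6_0123456789 ∷ 1_6523910784 ∷ []) ∷
  step 10_30_40_21_32_52_63_65_96 8 (7_6523910784 ∷ 1_0123456789 ∷ 7_0123456789 ∷ 0_0123456789 ∷ 1_6523910784 ∷ []) ∷
  step 10_30_40_21_32_52_63_65 6 (68_2165304789 ∷ 33_0123456789 ∷ 0_0123456897 ∷ 0_0123456798 ∷ 0_0123456789 ∷ []) ∷
  step 10_30_40_21_41_32_52_73_64_65_85_76_97_98 9 [] ∷
  step 10_30_40_21_41_32_52_73_64_65_76_97_98 8 (0_0123456789 ∷ []) ∷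
  step 10_30_40_21_41_32_52_73_64_65_85_76_97 8 (1_0123456789 ∷ []) ∷
  step 10_30_40_21_41_32_52_73_64_65_76_97 8 (0_0123456789 ∷ 1_0123456789 ∷ []) ∷
  step 10_30_40_21_91_32_52_73_64_84_65_76_97_98 5 (115_0123456789 ∷ []) ∷
  step 10_30_40_21_91_32_52_73_64_65_76_97_98 8 (0_0123456789 ∷ 0_2103546789 ∷ []) ∷
  step 10_30_40_21_91_32_52_73_64_65_76_97 9 (36_2301549867 ∷ 36_0321459867 ∷ 0_0123456789 ∷ []) ∷
  step 10_30_40_21_81_32_52_73_64_65_76_97_98 8 (26_2301548769 ∷ 26_0321458769 ∷ []) ∷
  step 10_30_40_21_81_32_52_73_64_65_76_97 8 (17_4810623957 ∷ 17_5812603947 ∷ 0_0123456789 ∷ []) ∷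
  step 10_30_40_21_32_52_73_64_65_76_97 1 (5_0123456789 ∷ 5_2103546789 ∷ 0_0123456789 ∷ 2_0123456789 ∷ []) ∷
  step 10_30_40_21_32_52_73_64_65_76 7 (65_1032746895 ∷ 11_2103547896 ∷ 11_0123457896 ∷ 0_0123456798 ∷ 0_0123456789 ∷ []) ∷
  step 10_30_40_21_31_32_52_64_74_65_75_76_98 9 [] ∷
  step 10_30_40_21_31_32_52_64_74_65_75_76 8 (0_0123456789 ∷ []) ∷
  step 10_30_40_21_32_52_83_64_74_65_75_76_98 8 (77_1032849675 ∷ []) ∷
  step 10_30_40_21_32_52_83_64_74_65_75_76 8 (68_1038245679 ∷ 0_0123456789 ∷ []) ∷
  step 10_30_40_21_32_52_64_74_65_75_76 3 (2_0123456789 ∷ 0_0123456789 ∷ 0_0123456798 ∷ []) ∷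
  step 10_30_40_21_41_32_52_83_64_65_75_76_87_98 9 [] ∷
  step 10_30_40_21_41_32_52_64_65_75_76_87_98 8 (0_0123456789 ∷ []) ∷
  step 10_30_40_21_41_32_52_93_64_65_75_76_87 9 (0_0123456789 ∷ []) ∷
  step 10_30_40_21_41_32_52_64_65_75_76_87 9 (0_0123456789 ∷ 1_0123456789 ∷ []) ∷
  step 10_30_40_21_91_32_52_64_84_65_75_76_87_98 3 (123_1230958764 ∷ []) ∷
  step 10_30_40_21_32_52_64_84_65_75_76_87_98 9 (0_0123456789 ∷ 0_0321456789 ∷ []) ∷
  step 10_30_40_21_32_52_64_84_65_75_76_87 8 (42_6784510923 ∷ 42_6784530921 ∷ 0_0123456789 ∷ []) ∷
  step 10_30_40_21_32_52_64_94_65_75_76_87_98 9 (32_2301549768 ∷ 32_2103549768 ∷ []) ∷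
  step 10_30_40_21_32_52_64_94_65_75_76_87 9 (24_2301549678 ∷ 24_2103549678 ∷ 0_0123456789 ∷ []) ∷
  step 10_30_40_21_32_52_64_65_75_76_87 4 (5_0123456789 ∷ 5_0321456789 ∷ 2_0123456789 ∷ 0_0123456789 ∷ []) ∷
  step 10_30_40_21_32_52_64_65_75_76 7 (27_0321457896 ∷ 27_0123457896 ∷ 10_0123456789 ∷ 0_0123456789 ∷ 0_0123456798 ∷ []) ∷
  step 10_30_40_21_81_32_52_53_64_65_76_87_97_98 9 (139_0123456789 ∷ []) ∷
  step 10_30_40_21_81_32_52_93_64_65_76_87_97_98 5 (141_0123456789 ∷ []) ∷
  step 10_30_40_21_81_32_52_64_65_76_87_97_98 3 (1_2103546789 ∷ 1_0123456789 ∷ 0_0123456789 ∷ []) ∷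
  step 10_30_40_21_32_52_64_84_65_76_87_97_98 9 (0_0123456798 ∷ 0_0321456798 ∷ 35_4876095312 ∷ []) ∷
  step 10_30_40_21_32_52_64_65_76_87_97_98 8 (1_0123456789 ∷ 1_0321456789 ∷ 0_0123456789 ∷ 0_2103546789 ∷ []) ∷
  step 10_30_40_21_32_52_64_65_95_76_87_97 9 (45_1259067348 ∷ 45_3259067148 ∷ 91_6495708312 ∷ 1_2103546798 ∷ []) ∷
  step 10_30_40_21_91_32_52_64_65_76_87_97 9 (99_1930275864 ∷ 46_1049267358 ∷ 46_1259067348 ∷ 3_0123456798 ∷ []) ∷
  step 10_30_40_21_32_52_64_65_76_87_97 9 (0_0123456789 ∷ 0_0321456789 ∷ 1_2103546789 ∷ 1_0123456789 ∷ 2_0123456789 ∷ []) ∷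
  step 10_30_40_21_32_52_64_65_76_97 7 (25_0321456789 ∷ 25_0123456789 ∷ 9_2103546798 ∷ 9_0123456798 ∷ 0_0123456789 ∷ []) ∷
  step 10_30_40_21_32_52_64_65_76 7 (25_0321456789 ∷ 25_0123456789 ∷ 9_2103546789 ∷ 9_0123456789 ∷ 0_0123456798 ∷ 0_0123456789 ∷ []) ∷
  step 10_30_40_21_32_52_64_65 6 (71_0321456789 ∷ 71_0123456789 ∷ 0_0123456789 ∷ 0_0123456879 ∷ 0_0123456978 ∷ []) ∷
  step 10_30_40_21_41_32_52_53_84_65_76_86_87_97 9 [] ∷
  step 10_30_40_21_41_32_52_53_84_65_76_86_87 9 (0_0123456789 ∷ []) ∷
  step 10_30_40_21_41_32_52_53_84_65_76_86_97_98 9 [] ∷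
  step 10_30_40_21_41_32_52_53_84_65_76_86_98 7 (0_0123456789 ∷ []) ∷
  step 10_30_40_21_41_32_52_53_84_65_76_86 8 (2_0123456789 ∷ 0_0123456789 ∷ []) ∷
  step 10_30_40_21_41_32_52_53_94_65_76_86_87_97 8 (157_0123456879 ∷ []) ∷
  step 10_30_40_21_41_32_52_53_94_65_76_86_97 7 (0_0123456789 ∷ []) ∷
  step 10_30_40_21_41_32_52_53_94_65_76_86 9 (0_0123456789 ∷ 0_0123456879 ∷ []) ∷
  step 10_30_40_21_41_32_52_53_65_76_86 4 (3_0123456879 ∷ 3_0123456789 ∷ 0_0123456879 ∷ []) ∷
  step 10_30_40_21_91_32_52_53_84_65_76_86 4 (25_4867053219 ∷ 53_3210594768 ∷ []) ∷
  step 10_30_40_21_91_32_52_53_65_76_86 4 (0_0123456879 ∷ 0_0123456789 ∷ 48_2301549678 ∷ []) ∷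
  step 10_30_40_21_32_52_53_65_76_86 1 (2_0123456879 ∷ 12_1032756849 ∷ 12_1032856749 ∷ 0_0123456879 ∷ []) ∷
  step 10_30_40_21_31_32_52_54_84_65_76_86_87_97 9 [] ∷
  step 10_30_40_21_31_32_52_54_84_65_76_86_87 7 (0_0123456789 ∷ []) ∷
  step 10_30_40_21_31_32_52_54_84_65_76_86_98 9 (52_4568079123 ∷ []) ∷
  step 10_30_40_21_31_32_52_54_84_65_76_86 8 (1_0123456789 ∷ 0_0123456789 ∷ []) ∷
  step 10_30_40_21_32_52_93_54_84_65_76_86 1 (44_4865071293 ∷ 85_3210984765 ∷ 108_1039245678 ∷ []) ∷
  step 10_30_40_21_32_52_54_84_65_76_86 3 (1_0123456789 ∷ 45_4865073291 ∷ 85_6548703912 ∷ 0_0123456789 ∷ []) ∷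
  step 10_30_40_21_31_32_52_54_94_65_76_86_97_98 8 (171_0123456879 ∷ []) ∷
  step 10_30_40_21_81_32_52_54_94_65_76_86_97_98 7 (168_1032876594 ∷ []) ∷
  step 10_30_40_21_32_52_54_94_65_76_86_97_98 1 (1_0123456879 ∷ 0_0123456879 ∷ 0_0123456789 ∷ []) ∷
  step 10_30_40_21_32_52_54_94_65_76_86_98 9 (65_2301549768 ∷ 65_2103549768 ∷ 0_0123456879 ∷ []) ∷
  step 10_30_40_21_32_52_54_94_65_76_86 9 (60_2301549678 ∷ 60_2103549678 ∷ 0_0123456879 ∷ 0_0123456789 ∷ []) ∷
  step 10_30_40_21_32_52_54_65_76_86 4 (61_5412603789 ∷ 61_5432601789 ∷ 5_0123456879 ∷ 5_0123456789 ∷ 0_0123456879 ∷ []) ∷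
  step 10_30_40_21_32_52_84_94_65_75_76_86_87 9 (62_2301549678 ∷ 62_2103549678 ∷ []) ∷
  step 10_30_40_21_32_52_84_65_75_76_86_87 4 (40_5687241039 ∷ 40_5687243019 ∷ 0_0123456789 ∷ []) ∷
  step 10_30_40_21_32_52_94_65_75_76_86_87_98 9 (72_2301549678 ∷ 72_2103549678 ∷ []) ∷
  step 10_30_40_21_32_52_65_75_76_86_87_98 9 (32_8657921043 ∷ 32_8657923041 ∷ 0_0123456789 ∷ []) ∷
  step 10_30_40_21_32_52_65_75_76_86_87 8 (12_5687210439 ∷ 12_5687230419 ∷ 2_0123456789 ∷ 0_0123456789 ∷ []) ∷
  step 10_30_40_21_32_52_94_65_75_76_86_97 9 (73_2301549867 ∷ 73_2103549867 ∷ 17_9867452130 ∷ []) ∷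
  step 10_30_40_21_32_52_43_65_75_76_86_97 4 (163_1034287569 ∷ 0_0123457698 ∷ 0_0123456789 ∷ []) ∷
  step 10_30_40_21_32_52_65_75_76_86_97 4 (0_0321456789 ∷ 0_0123456789 ∷ 1_0123457698 ∷ 1_0123456789 ∷ []) ∷
  step 10_30_40_21_32_52_65_75_76_86 7 (73_7521630984 ∷ 73_7523610984 ∷ 44_0123457689 ∷ 3_0123456789 ∷ 0_0123456789 ∷ []) ∷
  step 10_30_40_21_32_52_65_95_76_86_98 9 (80_0321459768 ∷ 80_0123459768 ∷ 35_0123459876 ∷ 124_6598720134 ∷ []) ∷
  step 10_30_40_21_32_52_65_95_76_86 9 (72_0321459678 ∷ 72_0123459678 ∷ 34_0123459678 ∷ 0_0123456879 ∷ 0_0123456789 ∷ []) ∷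
  step 10_30_40_21_32_52_65_76_86 5 (23_0321456879 ∷ 23_0123456879 ∷ 11_0123456879 ∷ 2_0123456789 ∷ 2_0123456879 ∷ 0_0123456879 ∷ []) ∷
  step 10_30_40_21_32_52_65_76 6 (75_0321456897 ∷ 75_0123456897 ∷ 37_0123456789 ∷ 0_0123456879 ∷ 0_0123456978 ∷ []) ∷
  step 10_30_40_21_32_52_65 6 (75_0321456789 ∷ 75_0123456789 ∷ 37_0123456789 ∷ 0_0123456789 ∷ 0_0123456879 ∷ 0_0123456978 ∷ []) ∷
  step 10_30_40_21_61_32_52_86_96 3 (0_3012468579 ∷ 0_3012568479 ∷ 0_3012768459 ∷ 0_3012869457 ∷ 0_3012968457 ∷ []) ∷
  step 10_30_40_21_61_32_52_86 6 (132_1032648795 ∷ 78_2301546798 ∷ 78_0321456798 ∷ 0_0123456987 ∷ 0_0123456789 ∷ []) ∷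
  step 10_30_40_21_61_32_52 6 (132_1036245789 ∷ 78_2301546789 ∷ 78_0321456789 ∷ 0_0123456879 ∷ 0_0123456789 ∷ 0_0123456798 ∷ []) ∷
  step 10_30_40_21_32_52_43_54_76_86_96_87_97_98 1 (195_0123456897 ∷ []) ∷
  step 10_30_40_21_32_52_43_76_86_96_87_97_98 4 (168_1034267589 ∷ 0_0123456897 ∷ []) ∷
  step 10_30_40_21_31_32_52_54_76_86_96_87_97_98 4 [] ∷
  step 10_30_40_21_31_32_52_76_86_96_87_97_98 4 (0_0123456897 ∷ []) ∷
  step 10_30_40_21_32_52_76_86_96_87_97_98 3 (0_0123456897 ∷ 2_0123456897 ∷ 2_2103546897 ∷ []) ∷
  step 10_30_40_21_32_52_86_96_87_97_98 7 (7_0123457689 ∷ 7_0321457689 ∷ 10_2103547896 ∷ 10_0123457896 ∷ 0_0123456897 ∷ []) ∷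
  step 10_30_40_21_32_52_96_87_97_98 8 (8_0123458697 ∷ 8_0321458697 ∷ 11_2103548976 ∷ 11_0123458976 ∷ 0_0123456789 ∷ []) ∷
  step 10_30_40_21_32_52_96_97_98 8 (8_0123458697 ∷ 8_0321458697 ∷ 11_2103548967 ∷ 11_0123458967 ∷ 0_0123457869 ∷ 0_0123456879 ∷ []) ∷
  step 10_30_40_21_32_52_96_98 9 (10_0123459786 ∷ 10_0321459786 ∷ 13_2103549867 ∷ 13_0123459867 ∷ 0_0123458679 ∷ []) ∷
  step 10_30_40_21_32_52_96 9 (10_0123459768 ∷ 10_0321459768 ∷ 13_2103549678 ∷ 13_0123459678 ∷ 0_0123456879 ∷ 0_0123458769 ∷ []) ∷
  step 10_30_40_21_32_52 6 (10_0123456789 ∷ 10_0321456789 ∷ 13_2103546789 ∷ 13_0123456789 ∷ 0_0123456897 ∷ 0_0123456798 ∷ 0_0123456789 ∷ []) ∷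
  step 10_30_40_21_32 2 (142_0123456789 ∷ 0_0123456789 ∷ 0_0123465789 ∷ 0_0123475689 ∷ 0_0123485679 ∷ 0_0123495678 ∷ []) ∷
  step 10_20_30_21_31_32_54_64_74_86_98 8 (7_4586790123 ∷ 7_4687590123 ∷ []) ∷
  step 10_20_30_21_31_32_54_64_74_86 8 (1_4586701239 ∷ 1_4687501239 ∷ 0_0123456789 ∷ []) ∷
  step 10_20_30_21_31_32_54_64_74_98 9 (1_0123465798 ∷ 1_0123456798 ∷ 1_0123457698 ∷ []) ∷
  step 10_20_30_21_31_32_54_64_74 8 (1_0123465789 ∷ 1_0123456789 ∷ 1_0123457689 ∷ 0_0123456789 ∷ []) ∷
  step 10_20_30_21_32_54_64_74 3 (0_0123456789 ∷ 4_3012546789 ∷ 4_3012645789 ∷ 4_3012745689 ∷ 4_3012845679 ∷ 4_3012945678 ∷ []) ∷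
  step 10_30_21_32_54_64_74 2 (0_0123456789 ∷ 5_2103546789 ∷ 5_2103645789 ∷ 5_2103745689 ∷ 5_2103845679 ∷ 5_2103945678 ∷ []) ∷
  step 10_30_21_32_54_74 4 (6_0123456789 ∷ 6_1032456789 ∷ 6_2103456789 ∷ 6_3012456789 ∷ 0_0123456789 ∷ 0_0123485769 ∷ 0_0123495768 ∷ []) ∷
  step 10_30_21_32_74 4 (7_0123456789 ∷ 7_1032456789 ∷ 7_2103456789 ∷ 7_3012456789 ∷ 0_0123456789 ∷ 0_0123465789 ∷ 0_0123485769 ∷ 0_0123495768 ∷ []) ∷
  -- A bare 4-cycle: every graph containing one is settled from here on, which leaves the last three
  -- representatives to be reached.
  step 10_30_21_32 4 (8_0123456789 ∷ 8_1032456789 ∷ 8_2103456789 ∷ 8_3012456789 ∷ 0_0123467589 ∷ 0_0123457689 ∷ 0_0123456789 ∷ 0_0123456879 ∷ 0_0123456978 ∷ []) ∷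
  step 10_80_71_81_32_52_92_43_63_64_75_95_76_98 0 (217_0123456789 ∷ []) ∷
  step 10_71_81_32_52_92_43_63_64_84_75_95_76_98 0 [] ∷
  step 10_71_81_32_52_92_43_63_64_75_95_76_98 8 (1_0123456789 ∷ 0_0132549876 ∷ []) ∷
  step 71_81_32_52_92_43_63_64_75_95_76_98 1 (0_0123456789 ∷ 83_4671352980 ∷ []) ∷
  step 10_71_32_52_92_43_63_64_75_95_76_98 1 (85_4671352980 ∷ 1_0123456789 ∷ []) ∷
  step 71_32_52_92_43_63_64_75_95_76_98 1 (0_0123456789 ∷ 85_4671352980 ∷ 1_0123456789 ∷ []) ∷
  step 10_80_41_71_32_52_92_43_63_75_95_76_86_98 4 (224_0123456789 ∷ []) ∷
  step 10_80_71_32_52_92_43_63_75_95_76_86_98 1 (0_4198056732 ∷ []) ∷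
  step 80_71_32_52_92_43_63_75_95_76_86_98 0 (0_1023496875 ∷ 0_4057196832 ∷ []) ∷
  step 71_32_52_92_43_63_75_95_76_86_98 8 (0_1023496875 ∷ 99_7186592304 ∷ 99_3486295701 ∷ []) ∷
  step 60_80_71_32_52_92_43_63_75_95_76_98 0 (84_0176859234 ∷ 84_0436829571 ∷ []) ∷
  step 60_71_32_52_92_43_63_75_95_76_98 0 (20_6017324589 ∷ 20_3406215789 ∷ 0_0123456789 ∷ []) ∷
  step 71_32_52_92_43_63_75_95_76_98 6 (0_0123456789 ∷ 6_0457126389 ∷ 6_0123456789 ∷ 2_0123456789 ∷ []) ∷
  step 32_52_92_43_63_75_95_76_98 7 (0_1023456789 ∷ 0_0123456789 ∷ 76_3476259801 ∷ 76_7895623401 ∷ []) ∷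
  step 70_71_32_52_92_43_63_75_95_98 8 (0_4657190832 ∷ 0_4657091832 ∷ 0_0123694875 ∷ 0_0123496875 ∷ []) ∷
  step 70_32_52_92_43_63_75_95_98 7 (0_0123456789 ∷ 2_1023654789 ∷ 2_1023456789 ∷ 65_7895023461 ∷ []) ∷
  step 32_52_92_43_63_75_95_98 7 (0_0123456789 ∷ 0_1023456789 ∷ 2_0123654789 ∷ 2_0123456789 ∷ 25_5987201346 ∷ []) ∷
  step 32_52_92_63_75_95_98 3 (0_1423096875 ∷ 0_0423196875 ∷ 0_0123496875 ∷ 41_3257698014 ∷ 41_3892657014 ∷ []) ∷
  step 32_52_92_75_95_98 3 (0_1423690875 ∷ 0_0423691875 ∷ 0_0123694875 ∷ 0_0123496875 ∷ 27_2375901468 ∷ 27_2983501467 ∷ []) ∷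
  step 32_52_92_75_95 9 (0_1423698075 ∷ 0_0423698175 ∷ 28_5932701468 ∷ 0_0123698475 ∷ 0_0123498675 ∷ 28_2975301468 ∷ 0_0123496875 ∷ []) ∷
  step 52_92_75_95 2 (0_1320456789 ∷ 0_0321456789 ∷ 0_0123456789 ∷ 0_0124356789 ∷ 0_0126354789 ∷ 20_2957013468 ∷ 0_0128354769 ∷ []) ∷
  step 10_30_90_21_61_42_52_73_84_75_95_76_86_98 3 (240_0123456789 ∷ []) ∷
  step 10_90_21_61_42_52_73_84_75_95_76_86_98 0 (0_0123456789 ∷ 128_1240689375 ∷ []) ∷
  step 90_21_61_42_52_73_84_75_95_76_86_98 1 (0_0123456789 ∷ 63_1376259084 ∷ 120_1486295703 ∷ []) ∷
  step 90_21_42_52_73_84_75_95_76_86_98 6 (63_6098752143 ∷ 0_3420158967 ∷ 4_0168274593 ∷ 15_3042185976 ∷ []) ∷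
  step 90_21_42_52_73_84_75_95_76_98 8 (5_1284396570 ∷ 64_8124957360 ∷ 0_0126453789 ∷ 0_0123456789 ∷ []) ∷
  step 90_21_42_52_73_75_95_76_98 4 (0_8123456709 ∷ 5_0316728594 ∷ 0_6120458937 ∷ 0_3120458967 ∷ 0_0123456789 ∷ []) ∷
  step 21_42_52_73_75_95_76_98 9 (0_3120458967 ∷ 50_2591487036 ∷ 50_7593682014 ∷ 50_2594187036 ∷ 50_7596382014 ∷ []) ∷
  step 21_42_52_73_75_95_76 9 (0_8123456709 ∷ 37_2195403678 ∷ 37_5937201468 ∷ 37_2495103678 ∷ 37_5967201348 ∷ 0_0123456789 ∷ []) ∷
  step 21_42_52_73_75_95 7 (0_6120453789 ∷ 50_2571439068 ∷ 50_2574139068 ∷ 0_0123456789 ∷ 0_0128453769 ∷ 9_0152476389 ∷ []) ∷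
  step 42_52_73_75_95 2 (0_1023456789 ∷ 0_0123456789 ∷ 39_2375401689 ∷ 0_0423651789 ∷ 11_0124658937 ∷ 0_0823451769 ∷ 10_0124356789 ∷ []) ∷
  step 42_52_75_95 7 (0_1320456789 ∷ 0_0321456789 ∷ 11_0124356987 ∷ 0_0123456789 ∷ 40_5247901368 ∷ 0_0126453789 ∷ 0_0128453769 ∷ 10_0193456287 ∷ []) ∷
  step 52_75_95 2 (0_1324056987 ∷ 0_0324156987 ∷ 0_0124356987 ∷ 0_0123456987 ∷ 0_0123654987 ∷ 11_0123456987 ∷ 0_0123854967 ∷ 11_0193456782 ∷ []) ∷
  step 52_95 5 (0_1304657982 ∷ 0_0394657281 ∷ 0_0194657283 ∷ 0_0193657284 ∷ 0_0193457286 ∷ 0_0193456287 ∷ 0_0183456972 ∷ []) ∷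
  step 52 5 (0_1304657892 ∷ 0_0314657892 ∷ 0_0124657893 ∷ 0_0123657894 ∷ 0_0123457896 ∷ 0_0123456897 ∷ 0_0183456792 ∷ 0_0193456782 ∷ []) ∷
  -- The decimal 0 encodes the empty set. Each of the nine possible edges at 5 is a copy of the
  -- single edge settled just before.
  step 0 5 (0_1203456789 ∷ 0_0213456789 ∷ 0_0123456789 ∷ 0_0132456789 ∷ 0_0142356789 ∷ 0_0152364789 ∷ 0_0152374689 ∷ 0_0152384679 ∷ 0_0152394678 ∷ []) ∷ []

derivation-checks : T (check representatives derivation)
derivation-checks = tt
representatives-regular : All Regular representatives
representatives-regular = All.map (λ {E} → regular?-sound E) (All.all⁺ regular? representatives tt)

distinct-signatures : Unique (map signature representatives)
distinct-signatures = from-yes (unique? (map signature representatives))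

theorem5p1 : (G : Graph 10) → Cubic G → {m : ℕ} → (H : Graph m) →
    (∀ i → EdgeCoverPoly H i ≡ EdgeCoverPoly G i) → H ≅ G
theorem5p1 = Determination.determined refl representatives derivation
  representatives-regular distinct-signatures derivation-checks
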